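{- Let $k \geq 3$ be an integer and let $n = 2^k + 7k$. Then there exists a function $f : \mathbb{F}_2^n \to \{ -1,1\}$ such that, writing $\mathcal{S} = \mathrm{supp}(\widehat{f})$, we have $|\mathcal{S}| \geq 2^{6k}$, and yet for all distinct $\gamma_1, \gamma_2 \in \mathbb{F}_2^n$, \[ |(\mathcal{S} + \gamma_1) \cap (\mathcal{S} + \gamma_2)| \leq 2^{5k+4}. \]
   Context: Every $f : \mathbb{F}_2^n \to \mathbb{R}$ has a unique Fourier expansion $f = \sum_{\alpha \in \mathbb{F}_2^n} \widehat{f}(\alpha)\chi_\alpha$, where $\chi_\alpha(x) = (-1)^{\langle x, \alpha\rangle}$ and $\widehat{f}(\alpha) = \mathbb{E}_{x \in \mathbb{F}_2^n}[f(x)\chi_\alpha(x)]$. The Fourier support is $\mathrm{supp}(\widehat{f}) = \{\alpha \in \mathbb{F}_2^n : \widehat{f}(\alpha) \neq 0\}$. For a set $\mathcal{S} \subseteq \mathbb{F}_2^n$ and $\gamma \in \mathbb{F}_2^n$, $\mathcal{S} + \gamma = \{s + \gamma : s \in \mathcal{S}\}$. -}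

module Defs where

open import Data.Bool using (Bool; true; false; _∧_; _xor_; not; if_then_else_)
open import Data.Nat using (ℕ; zero; suc)
open import Data.Integer using (ℤ; _*_; _+_) renaming (0ℤ to z0; 1ℤ to z1; -1ℤ to zm1)
import Data.Integer as ℤ
open import Data.Vec using (Vec; []; _∷_; zipWith; foldr)
open import Data.List using (List; []; _∷_; _++_; map; length; filterᵇ)
open import Relation.Nullary.Decidable using (isYes)
open import Relation.Binary.PropositionalEquality using (_≡_)
open import Data.Sum using (_⊎_)

-- The vector space F₂ⁿ, with F₂ represented by Bool (false = 0, true = 1).
F₂^ : ℕ → Set
F₂^ n = Vec Bool n

_⊕_ : ∀ {n} → F₂^ n → F₂^ n → F₂^ n
_⊕_ = zipWith _xor_

⟨_,_⟩ : ∀ {n} → F₂^ n → F₂^ n → Bool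
⟨ x , α ⟩ = foldr (λ _ → Bool) _xor_ false (zipWith _∧_ x α)

χ : ∀ {n} → F₂^ n → F₂^ n → ℤ
χ α x = if ⟨ x , α ⟩ then zm1 else z1

allVecs : (n : ℕ) → List (F₂^ n)
allVecs zero = [] ∷ []
allVecs (suc n) = map (false ∷_) (allVecs n) ++ map (true ∷_) (allVecs n)

sumℤ : List ℤ → ℤ
sumℤ [] = z0
sumℤ (a ∷ as) = a + sumℤ as

-- Unnormalised Fourier coefficient: 2ⁿ · f̂(α) = Σ_x f(x) χ_α(x).
-- (f̂(α) ≠ 0 iff this integer is ≠ 0.)
fourierSum : ∀ {n} → (F₂^ n → ℤ) → F₂^ n → ℤ
fourierSum {n} f α = sumℤ (map (λ x → f x * χ α x) (allVecs n))

inSupp : ∀ {n} → (F₂^ n → ℤ) → F₂^ n → Bool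
inSupp f α = not (isYes (fourierSum f α ℤ.≟ z0))

suppSize : ∀ {n} → (F₂^ n → ℤ) → ℕ
suppSize {n} f = length (filterᵇ (inSupp f) (allVecs n))

-- |(S + γ₁) ∩ (S + γ₂)| where S = supp(f̂); α ∈ S + γ iff α + γ ∈ S (char 2).
shiftInterSize : ∀ {n} → (F₂^ n → ℤ) → F₂^ n → F₂^ n → ℕ
shiftInterSize {n} f γ₁ γ₂ =
  length (filterᵇ (λ α → inSupp f (α ⊕ γ₁) ∧ inSupp f (α ⊕ γ₂)) (allVecs n))

IsSignFunction : ∀ {n} → (F₂^ n → ℤ) → Set
IsSignFunction {n} f = (x : F₂^ n) → (f x ≡ z1) ⊎ (f x ≡ zm1)

{-# OPTIONS --safe #-}

-- Let K be the field with 2^E elements and let s(w) = s₀ + ι(w) run through an affine subspace of K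
-- that avoids 0, where the linear map ι has rank D. The function f(v, y, w) = (-1)^⟨y, v / s(w)⟩ has
-- as Fourier support the graph μ = Q(ν, α) of the bilinear map given by ⟨w, Q(ν, α)⟩ = ⟨α ι(w), ν⟩,
-- which has 2^(2E) points. Two distinct shifts of the graph meet where a derivative of Q takes a
-- prescribed value; this derivative is affine, and of rank at least D because K has no zero divisors,
-- so they share at most 2^(2E - D) points. It remains to take E ≥ 3k and D = 2E - 5k - 4. There are
-- enough coordinates if E is close to 3k, which the degrees 2^j and 3·2^j allow: from F₂ and F₈,
-- adjoin a root t of t² + t = κ repeatedly, replacing κ by κt.
module Submission where

open import Defs
open import Algebra.Bundles using (CommutativeRing; RawRing)
import Algebra.Solver.Ring as RingSolver
open import Algebra.Solver.Ring.AlmostCommutativeRing using (AlmostCommutativeRing; _-Raw-AlmostCommutative⟶_)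
open import Algebra.Structures using (IsCommutativeSemiring)
open import Algebra.Structures.Biased using (isCommutativeMonoidˡ; isCommutativeSemiringˡ)
open import Data.Bool using (Bool; true; false; _xor_; _∧_; not; if_then_else_)
import Data.Bool.Properties as Bool
open import Data.Bool.Solver using (module xor-∧-Solver)
open import Data.Integer using (ℤ; +_; 0ℤ; 1ℤ; -1ℤ; +≤+)
import Data.Integer as ℤ
import Data.Integer.Properties as ℤ
open import Data.Integer.Tactic.RingSolver using (solve-∀)
open import Data.List using (length; filterᵇ)
import Data.List as List
import Data.List.Properties as List
import Data.Maybe as Maybe
open import Data.Nat using (ℕ; zero; suc; _+_; _*_; _^_; _∸_; _≤_; _<_; z≤n; s≤s; _≤?_)
import Data.Nat.Properties as ℕ
open import Data.Nat.Solver using (module +-*-Solver)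
open import Data.Product using (Σ; ∃; _×_; _,_; proj₁; proj₂)
import Data.Product.Properties as Product
open import Data.Sum using (_⊎_; inj₁; inj₂)
open import Data.Vec using (Vec; []; _∷_; _++_; take; drop; replicate)
open import Data.Vec.Properties using (≡-dec; take++drop≡id; take-zipWith; drop-zipWith; zipWith-++; zipWith-assoc; zipWith-comm; zipWith-identityˡ; zipWith-identityʳ; ++-injective; ++-injectiveˡ; ++-injectiveʳ; ∷-injectiveʳ)
open import Level using (0ℓ)
open import Relation.Binary.Definitions using (DecidableEquality)
open import Relation.Binary.PropositionalEquality using (_≡_; _≢_; refl; sym; trans; cong; cong₂; subst; subst₂; module ≡-Reasoning)
open import Relation.Binary.PropositionalEquality.Algebra using (isMagma)
open import Relation.Nullary using (Dec; yes; no; contradiction; ¬?; _×-dec_)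
open import Relation.Nullary.Decidable using (dec⇒maybe; isYes; map′; toWitness)

-- Finite fields of characteristic two

-- The additive bijection with F₂^m fixes the order 2^m. The element `κ` lies outside the image of
-- x² + x, so that t² + t = κ is irreducible; it is carried along to make the quadratic extension
-- repeatable. The form of `invert` also decides whether an element is 0.
record BinaryField (m : ℕ) : Set₁ where
  infixl 6 _⊞_
  infixl 7 _⊠_
  field
    K : Set
    _⊞_ _⊠_ : K → K → K
    0K 1K : K
    isCommutativeSemiring : IsCommutativeSemiring _≡_ _⊞_ _⊠_ 0K 1K
    char2 : ∀ x → x ⊞ x ≡ 0K
    invert : ∀ x → x ≡ 0K ⊎ Σ K (λ y → x ⊠ y ≡ 1K)
    κ : K
    κ-irreducible : ∀ x → x ⊠ x ⊞ x ≢ κ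
    toVec : K → F₂^ m
    fromVec : F₂^ m → K
    from∘to : ∀ x → fromVec (toVec x) ≡ x
    to∘from : ∀ v → toVec (fromVec v) ≡ v
    toVec-⊞ : ∀ x y → toVec (x ⊞ y) ≡ toVec x ⊕ toVec y

  open IsCommutativeSemiring isCommutativeSemiring public
    using (+-assoc; +-identityˡ; +-identityʳ; +-comm; *-assoc; *-identityˡ; *-identityʳ; *-comm; zeroˡ; distribˡ; distribʳ)

  almostCommutativeRing : AlmostCommutativeRing 0ℓ 0ℓ
  almostCommutativeRing = record
    { -_ = λ x → x
    ; isAlmostCommutativeRing = record
      { isCommutativeSemiring = isCommutativeSemiring
      ; -‿cong = λ e → e
      ; -‿*-distribˡ = λ _ _ → refl
      ; -‿+-comm = λ _ _ → refl
      }
    }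

  private
    scalar : Bool → K
    scalar true = 1K
    scalar false = 0K

    scalar-+ : ∀ a b → scalar (a xor b) ≡ scalar a ⊞ scalar b
    scalar-+ true true = sym (char2 1K)
    scalar-+ true false = sym (+-identityʳ 1K)
    scalar-+ false b = sym (+-identityˡ (scalar b))

    scalar-* : ∀ a b → scalar (a ∧ b) ≡ scalar a ⊠ scalar b
    scalar-* true b = sym (*-identityˡ (scalar b))
    scalar-* false b = sym (zeroˡ (scalar b))

    F₂-rawRing : RawRing 0ℓ 0ℓ
    F₂-rawRing = CommutativeRing.rawRing Bool.xor-∧-commutativeRing

    scalarMorphism : F₂-rawRing -Raw-AlmostCommutative⟶ almostCommutativeRing
    scalarMorphism = record
      { ⟦_⟧ = scalar ; +-homo = scalar-+ ; *-homo = scalar-*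
      ; -‿homo = λ _ → refl ; 0-homo = refl ; 1-homo = refl }

  -- With coefficients in F₂ the solver also cancels x ⊞ x.
  module Solver = RingSolver F₂-rawRing almostCommutativeRing scalarMorphism
    (λ a b → Maybe.map (cong scalar) (dec⇒maybe (a Bool.≟ b)))

-- Doubling the degree by a root of t² + t = κ

module QuadraticExtension {m : ℕ} (F : BinaryField m) where
  open BinaryField F
  open Solver using (solve; _:+_; _:*_; _:=_; con)

  private
    L : Set
    L = K × K

    -- (a , b) stands for a + b t, where t² = t + κ.
    _+L_ _*L_ : L → L → L
    (a , b) +L (c , d) = a ⊞ c , b ⊞ d
    (a , b) *L (c , d) = a ⊠ c ⊞ b ⊠ d ⊠ κ , a ⊠ d ⊞ b ⊠ c ⊞ b ⊠ d

    -- The product of a + b t with its conjugate a + b (t + 1), as t + 1 is the other root of t² + t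
    -- = κ.
    norm : L → K
    norm (a , b) = a ⊠ a ⊞ a ⊠ b ⊞ b ⊠ b ⊠ κ

    *L-assoc : ∀ x y z → (x *L y) *L z ≡ x *L (y *L z)
    *L-assoc (a , b) (c , d) (e , f) = cong₂ _,_
      (solve 7 (λ a b c d e f k →
        (a :* c :+ b :* d :* k) :* e :+ (a :* d :+ b :* c :+ b :* d) :* f :* k :=
        a :* (c :* e :+ d :* f :* k) :+ b :* (c :* f :+ d :* e :+ d :* f) :* k) refl a b c d e f κ)
      (solve 7 (λ a b c d e f k →
        (a :* c :+ b :* d :* k) :* f :+ (a :* d :+ b :* c :+ b :* d) :* e :+ (a :* d :+ b :* c :+ b :* d) :* f :=
        a :* (c :* f :+ d :* e :+ d :* f) :+ b :* (c :* e :+ d :* f :* k) :+ b :* (c :* f :+ d :* e :+ d :* f)) refl a b c d e f κ)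

    *L-comm : ∀ x y → x *L y ≡ y *L x
    *L-comm (a , b) (c , d) = cong₂ _,_
      (solve 5 (λ a b c d k → a :* c :+ b :* d :* k := c :* a :+ d :* b :* k) refl a b c d κ)
      (solve 4 (λ a b c d → a :* d :+ b :* c :+ b :* d := c :* b :+ d :* a :+ d :* b) refl a b c d)

    *L-identityˡ : ∀ x → (1K , 0K) *L x ≡ x
    *L-identityˡ (a , b) = cong₂ _,_
      (solve 3 (λ a b k → con true :* a :+ con false :* b :* k := a) refl a b κ)
      (solve 2 (λ a b → con true :* b :+ con false :* a :+ con false :* b := b) refl a b)

    *L-zeroˡ : ∀ x → (0K , 0K) *L x ≡ (0K , 0K)
    *L-zeroˡ (a , b) = cong₂ _,_
      (solve 3 (λ a b k → con false :* a :+ con false :* b :* k := con false) refl a b κ)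
      (solve 2 (λ a b → con false :* b :+ con false :* a :+ con false :* b := con false) refl a b)

    *L-distribʳ : ∀ x y z → (y +L z) *L x ≡ (y *L x) +L (z *L x)
    *L-distribʳ (a , b) (c , d) (e , f) = cong₂ _,_
      (solve 7 (λ a b c d e f k → (c :+ e) :* a :+ (d :+ f) :* b :* k :=
        c :* a :+ d :* b :* k :+ (e :* a :+ f :* b :* k)) refl a b c d e f κ)
      (solve 6 (λ a b c d e f → (c :+ e) :* b :+ (d :+ f) :* a :+ (d :+ f) :* b :=
        c :* b :+ d :* a :+ d :* b :+ (e :* b :+ f :* a :+ f :* b)) refl a b c d e f)

    -- If b ≠ 0 and norm (a , b) = 0, then a / b solves x² + x = κ.
    norm≡0 : ∀ x → norm x ≡ 0K → x ≡ (0K , 0K)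
    norm≡0 (a , b) n≡0 with invert b
    ... | inj₂ (b' , bb'≡1) = contradiction
      (begin
        a ⊠ b' ⊠ (a ⊠ b') ⊞ a ⊠ b'
          ≡⟨ cong (a ⊠ b' ⊠ (a ⊠ b') ⊞_) (sym (trans (cong (a ⊠ b' ⊠_) bb'≡1) (*-identityʳ _))) ⟩
        a ⊠ b' ⊠ (a ⊠ b') ⊞ a ⊠ b' ⊠ (b ⊠ b')
          ≡⟨ solve 4 (λ a b c k → a :* c :* (a :* c) :+ a :* c :* (b :* c) :=
               (a :* a :+ a :* b :+ b :* b :* k) :* (c :* c) :+ (b :* c) :* (b :* c) :* k) refl a b b' κ ⟩
        norm (a , b) ⊠ (b' ⊠ b') ⊞ (b ⊠ b') ⊠ (b ⊠ b') ⊠ κ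
          ≡⟨ cong₂ (λ p q → p ⊠ (b' ⊠ b') ⊞ q ⊠ q ⊠ κ) n≡0 bb'≡1 ⟩
        0K ⊠ (b' ⊠ b') ⊞ 1K ⊠ 1K ⊠ κ
          ≡⟨ solve 2 (λ c k → con false :* (c :* c) :+ con true :* con true :* k := k) refl b' κ ⟩
        κ ∎)
      (κ-irreducible (a ⊠ b'))
      where open ≡-Reasoning
    ... | inj₁ refl with invert a
    ...   | inj₁ refl = refl
    ...   | inj₂ (a' , aa'≡1) = cong (_, 0K)
      (begin
        a ≡⟨ sym (trans (cong (a ⊠_) aa'≡1) (*-identityʳ a)) ⟩
        a ⊠ (a ⊠ a') ≡⟨ solve 3 (λ a c k → a :* (a :* c) :=
          (a :* a :+ a :* con false :+ con false :* con false :* k) :* c) refl a a' κ ⟩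
        norm (a , 0K) ⊠ a' ≡⟨ cong (_⊠ a') n≡0 ⟩
        0K ⊠ a' ≡⟨ zeroˡ a' ⟩
        0K ∎)
      where open ≡-Reasoning

    *L-invert : ∀ x → x ≡ (0K , 0K) ⊎ Σ L (λ y → x *L y ≡ (1K , 0K))
    *L-invert x@(a , b) with invert (norm x)
    ... | inj₁ n≡0 = inj₁ (norm≡0 x n≡0)
    -- The inverse is the conjugate (a + b) + b t divided by the norm.
    ... | inj₂ (n' , nn'≡1) = inj₂ (((a ⊞ b) ⊠ n' , b ⊠ n') , cong₂ _,_
      (trans (solve 4 (λ a b n k → a :* ((a :+ b) :* n) :+ b :* (b :* n) :* k :=
               (a :* a :+ a :* b :+ b :* b :* k) :* n) refl a b n' κ) nn'≡1)
      (solve 3 (λ a b n → a :* (b :* n) :+ b :* ((a :+ b) :* n) :+ b :* (b :* n) := con false) refl a b n'))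

  -- For z = p + q t the t-coordinate of z² + z is q² + q, so κ t is not of this form.
  quadraticExtension : BinaryField (m + m)
  quadraticExtension = record
    { K = L
    ; _⊞_ = _+L_
    ; _⊠_ = _*L_
    ; 0K = 0K , 0K
    ; 1K = 1K , 0K
    ; isCommutativeSemiring = isCommutativeSemiringˡ record
      { +-isCommutativeMonoid = isCommutativeMonoidˡ record
        { isSemigroup = record
          { isMagma = isMagma _+L_
          ; assoc = λ (a , b) (c , d) (e , f) → cong₂ _,_ (+-assoc a c e) (+-assoc b d f) }
        ; identityˡ = λ (a , b) → cong₂ _,_ (+-identityˡ a) (+-identityˡ b)
        ; comm = λ (a , b) (c , d) → cong₂ _,_ (+-comm a c) (+-comm b d) }
      ; *-isCommutativeMonoid = isCommutativeMonoidˡ record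
        { isSemigroup = record { isMagma = isMagma _*L_ ; assoc = *L-assoc }
        ; identityˡ = *L-identityˡ
        ; comm = *L-comm }
      ; distribʳ = *L-distribʳ
      ; zeroˡ = *L-zeroˡ }
    ; char2 = λ (a , b) → cong₂ _,_ (char2 a) (char2 b)
    ; invert = *L-invert
    ; κ = 0K , κ
    ; κ-irreducible = λ (p , q) eq → κ-irreducible q
        (trans (solve 2 (λ p q → q :* q :+ q := p :* q :+ q :* p :+ q :* q :+ q) refl p q) (cong proj₂ eq))
    ; toVec = λ (a , b) → toVec a ++ toVec b
    ; fromVec = λ v → fromVec (take m v) , fromVec (drop m v)
    ; from∘to = λ (a , b) → let e = take++drop≡id m (toVec a ++ toVec b) in cong₂ _,_
        (trans (cong fromVec (++-injectiveˡ _ _ e)) (from∘to a))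
        (trans (cong fromVec (++-injectiveʳ (take m (toVec a ++ toVec b)) _ e)) (from∘to b))
    ; to∘from = λ v → trans (cong₂ _++_ (to∘from (take m v)) (to∘from (drop m v))) (take++drop≡id m v)
    ; toVec-⊞ = λ (a , b) (c , d) → trans (cong₂ _++_ (toVec-⊞ a c) (toVec-⊞ b d))
        (sym (zipWith-++ _xor_ (toVec a) (toVec b) (toVec c) (toVec d)))
    }

open QuadraticExtension using (quadraticExtension)

-- The base fields F₂ and F₈ and the towers above them

GF2 : BinaryField 1
GF2 = record
  { K = Bool
  ; isCommutativeSemiring = CommutativeRing.isCommutativeSemiring Bool.xor-∧-commutativeRing
  ; char2 = Bool.xor-same
  ; invert = λ { false → inj₁ refl ; true → inj₂ (true , refl) }
  ; κ = true
  ; κ-irreducible = λ { false () ; true () }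
  ; toVec = λ b → b ∷ []
  ; fromVec = λ { (b ∷ []) → b }
  ; from∘to = λ _ → refl
  ; to∘from = λ { (b ∷ []) → refl }
  ; toVec-⊞ = λ _ _ → refl
  }

private
  O : Set
  O = Bool × Bool × Bool

  _+O_ _*O_ : O → O → O
  (a , b , c) +O (d , e , f) = a xor d , b xor e , c xor f
  -- Multiplication in F₂[x] / (x³ + x + 1).
  (a , b , c) *O (d , e , f) =
    (a ∧ d) xor (b ∧ f) xor (c ∧ e) ,
    (a ∧ e) xor (b ∧ d) xor (b ∧ f) xor (c ∧ e) xor (c ∧ f) ,
    (a ∧ f) xor (b ∧ e) xor (c ∧ d) xor (c ∧ f)

  0O 1O : O
  0O = false , false , false
  1O = true , false , false

  _≟O_ : DecidableEquality O
  _≟O_ = Product.≡-dec Bool._≟_ (Product.≡-dec Bool._≟_ Bool._≟_)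

  allBool? : {P : Bool → Set} → (∀ b → Dec (P b)) → Dec (∀ b → P b)
  allBool? P? = map′ (λ { (p , q) → λ { false → p ; true → q } }) (λ p → p false , p true)
    (P? false ×-dec P? true)

  -- Enumeration of the eight elements lets the ring laws of F₈ be checked by evaluation.
  allO? : {P : O → Set} → (∀ x → Dec (P x)) → Dec (∀ x → P x)
  allO? P? = map′ (λ { p (a , b , c) → p a b c }) (λ p a b c → p (a , b , c))
    (allBool? λ a → allBool? λ b → allBool? λ c → P? (a , b , c))

  *O-invert : ∀ x → x ≡ 0O ⊎ Σ O (λ y → x *O y ≡ 1O)
  *O-invert (false , false , false) = inj₁ refl
  *O-invert (true , false , false) = inj₂ ((true , false , false) , refl)
  *O-invert (false , true , false) = inj₂ ((true , false , true) , refl)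
  *O-invert (true , true , false) = inj₂ ((false , true , true) , refl)
  *O-invert (false , false , true) = inj₂ ((true , true , true) , refl)
  *O-invert (true , false , true) = inj₂ ((false , true , false) , refl)
  *O-invert (false , true , true) = inj₂ ((true , true , false) , refl)
  *O-invert (true , true , true) = inj₂ ((false , false , true) , refl)

GF8 : BinaryField 3
GF8 = record
  { K = O
  ; isCommutativeSemiring = isCommutativeSemiringˡ record
    { +-isCommutativeMonoid = isCommutativeMonoidˡ record
      { isSemigroup = record
        { isMagma = isMagma _+O_
        ; assoc = λ (a , b , c) (d , e , f) (g , h , i) → cong₂ _,_ (Bool.xor-assoc a d g)
            (cong₂ _,_ (Bool.xor-assoc b e h) (Bool.xor-assoc c f i)) }
      ; identityˡ = λ _ → refl
      ; comm = toWitness {a? = allO? λ x → allO? λ y → (x +O y) ≟O (y +O x)} _ }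
    ; *-isCommutativeMonoid = isCommutativeMonoidˡ record
      { isSemigroup = record
        { isMagma = isMagma _*O_
        ; assoc = toWitness
            {a? = allO? λ x → allO? λ y → allO? λ z → ((x *O y) *O z) ≟O (x *O (y *O z))} _ }
      ; identityˡ = toWitness {a? = allO? λ x → (1O *O x) ≟O x} _
      ; comm = toWitness {a? = allO? λ x → allO? λ y → (x *O y) ≟O (y *O x)} _ }
    ; distribʳ = toWitness
        {a? = allO? λ x → allO? λ y → allO? λ z → ((y +O z) *O x) ≟O ((y *O x) +O (z *O x))} _
    ; zeroˡ = λ _ → refl }
  ; char2 = toWitness {a? = allO? λ x → (x +O x) ≟O 0O} _
  ; invert = *O-invert
  -- Every x² + x has trace 0 over F₂, whereas 1 has trace 1 because the degree 3 is odd.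
  ; κ = 1O
  ; κ-irreducible = toWitness {a? = allO? λ x → ¬? (((x *O x) +O x) ≟O 1O)} _
  ; toVec = λ (a , b , c) → a ∷ b ∷ c ∷ []
  ; fromVec = λ { (a ∷ b ∷ c ∷ []) → a , b , c }
  ; from∘to = λ _ → refl
  ; to∘from = λ { (a ∷ b ∷ c ∷ []) → refl }
  ; toVec-⊞ = λ _ _ → refl
  }

-- Each extension supplies its own `κ`, so the doubling can be iterated; the transports only adjust
-- the index.
tower : ∀ {m} → BinaryField m → ∀ j → BinaryField (2 ^ j * m)
tower {m} F zero = subst BinaryField (sym (ℕ.+-identityʳ m)) F
tower {m} F (suc j) = subst BinaryField eq (quadraticExtension (tower F j))
  where
  eq : 2 ^ j * m + 2 ^ j * m ≡ 2 ^ suc j * m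
  eq = trans (sym (ℕ.*-distribʳ-+ m (2 ^ j) (2 ^ j))) (cong (λ p → (2 ^ j + p) * m) (sym (ℕ.+-identityʳ (2 ^ j))))

-- Linear algebra and character sums over F₂

𝟎 : ∀ {n} → F₂^ n
𝟎 = replicate _ false

⊕-assoc : ∀ {n} (x y z : F₂^ n) → (x ⊕ y) ⊕ z ≡ x ⊕ (y ⊕ z)
⊕-assoc = zipWith-assoc Bool.xor-assoc

⊕-comm : ∀ {n} (x y : F₂^ n) → x ⊕ y ≡ y ⊕ x
⊕-comm = zipWith-comm Bool.xor-comm

⊕-identityˡ : ∀ {n} (x : F₂^ n) → 𝟎 ⊕ x ≡ x
⊕-identityˡ = zipWith-identityˡ Bool.xor-identityˡ

⊕-identityʳ : ∀ {n} (x : F₂^ n) → x ⊕ 𝟎 ≡ x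
⊕-identityʳ = zipWith-identityʳ Bool.xor-identityʳ

⊕-self : ∀ {n} (x : F₂^ n) → x ⊕ x ≡ 𝟎
⊕-self [] = refl
⊕-self (a ∷ x) = cong₂ _∷_ (Bool.xor-same a) (⊕-self x)

⊕-cancel : ∀ {n} (x y : F₂^ n) → x ⊕ (x ⊕ y) ≡ y
⊕-cancel x y = trans (sym (⊕-assoc x x y)) (trans (cong (_⊕ y) (⊕-self x)) (⊕-identityˡ y))

⊕-≡𝟎 : ∀ {n} {x y : F₂^ n} → x ⊕ y ≡ 𝟎 → x ≡ y
⊕-≡𝟎 {x = x} {y} e = trans (sym (⊕-identityʳ x)) (trans (cong (x ⊕_) (sym e)) (⊕-cancel x y))

⊕-cancelˡ : ∀ {n} (x : F₂^ n) {y z} → x ⊕ y ≡ x ⊕ z → y ≡ z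
⊕-cancelˡ x {y} {z} e = trans (sym (⊕-cancel x y)) (trans (cong (x ⊕_) e) (⊕-cancel x z))

⟨⟩-comm : ∀ {n} (x a : F₂^ n) → ⟨ x , a ⟩ ≡ ⟨ a , x ⟩
⟨⟩-comm [] [] = refl
⟨⟩-comm (b ∷ x) (c ∷ a) = cong₂ _xor_ (Bool.∧-comm b c) (⟨⟩-comm x a)

⟨⟩-⊕ˡ : ∀ {n} (x y a : F₂^ n) → ⟨ x ⊕ y , a ⟩ ≡ ⟨ x , a ⟩ xor ⟨ y , a ⟩
⟨⟩-⊕ˡ [] [] [] = refl
⟨⟩-⊕ˡ (b ∷ x) (c ∷ y) (d ∷ a) = trans (cong (((b xor c) ∧ d) xor_) (⟨⟩-⊕ˡ x y a))
  (solve 5 (λ b c d p q → (b :+ c) :* d :+ (p :+ q) := (b :* d :+ p) :+ (c :* d :+ q))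
    refl b c d ⟨ x , a ⟩ ⟨ y , a ⟩)
  where open xor-∧-Solver using (solve; _:+_; _:*_; _:=_)

⟨⟩-⊕ʳ : ∀ {n} (x a b : F₂^ n) → ⟨ x , a ⊕ b ⟩ ≡ ⟨ x , a ⟩ xor ⟨ x , b ⟩
⟨⟩-⊕ʳ x a b = trans (⟨⟩-comm x (a ⊕ b)) (trans (⟨⟩-⊕ˡ a b x) (cong₂ _xor_ (⟨⟩-comm a x) (⟨⟩-comm b x)))

⟨⟩-𝟎ˡ : ∀ {n} (a : F₂^ n) → ⟨ 𝟎 , a ⟩ ≡ false
⟨⟩-𝟎ˡ [] = refl
⟨⟩-𝟎ˡ (_ ∷ a) = ⟨⟩-𝟎ˡ a

⟨⟩-++ : ∀ {m n} (x a : F₂^ m) {y b : F₂^ n} → ⟨ x ++ y , a ++ b ⟩ ≡ ⟨ x , a ⟩ xor ⟨ y , b ⟩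
⟨⟩-++ [] [] = refl
⟨⟩-++ (c ∷ x) (d ∷ a) = trans (cong ((c ∧ d) xor_) (⟨⟩-++ x a)) (sym (Bool.xor-assoc (c ∧ d) _ _))

-- Pairing with a unit vector reads off a coordinate.
⟨⟩-nondegenerate : ∀ {n} (a : F₂^ n) → (∀ x → ⟨ x , a ⟩ ≡ false) → a ≡ 𝟎
⟨⟩-nondegenerate [] _ = refl
⟨⟩-nondegenerate (b ∷ a) h = cong₂ _∷_
  (trans (sym (trans (cong (b xor_) (⟨⟩-𝟎ˡ a)) (Bool.xor-identityʳ b))) (h (true ∷ 𝟎)))
  (⟨⟩-nondegenerate a (λ x → h (false ∷ x)))

Additive : ∀ {n} → (F₂^ n → Bool) → Set
Additive ℓ = ∀ x y → ℓ (x ⊕ y) ≡ ℓ x xor ℓ y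

-- The vector representing the linear form ℓ: its coordinates are the values of ℓ at the unit
-- vectors.
dual : ∀ {n} → (F₂^ n → Bool) → F₂^ n
dual {zero} ℓ = []
dual {suc n} ℓ = ℓ (true ∷ 𝟎) ∷ dual (λ x → ℓ (false ∷ x))

xor-idem⇒false : ∀ b → b ≡ b xor b → b ≡ false
xor-idem⇒false b e = trans e (Bool.xor-same b)

⟨⟩-dual : ∀ {n} (ℓ : F₂^ n → Bool) → Additive ℓ → ∀ x → ⟨ x , dual ℓ ⟩ ≡ ℓ x
⟨⟩-dual ℓ add [] = sym (xor-idem⇒false (ℓ []) (add [] []))
⟨⟩-dual ℓ add (false ∷ x) = ⟨⟩-dual (λ x → ℓ (false ∷ x)) (λ x y → add (false ∷ x) (false ∷ y)) x
⟨⟩-dual ℓ add (true ∷ x) = trans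
  (cong (ℓ (true ∷ 𝟎) xor_) (⟨⟩-dual (λ x → ℓ (false ∷ x)) (λ x y → add (false ∷ x) (false ∷ y)) x))
  (trans (sym (add (true ∷ 𝟎) (false ∷ x))) (cong (λ y → ℓ (true ∷ y)) (⊕-identityˡ x)))

-- Signs and sums over F₂^n

sgn : Bool → ℤ
sgn b = if b then -1ℤ else 1ℤ

sgn-xor : ∀ a b → sgn (a xor b) ≡ sgn a ℤ.* sgn b
sgn-xor false b = sym (ℤ.*-identityˡ (sgn b))
sgn-xor true false = refl
sgn-xor true true = refl

-- Recursion on the coordinates, rather than a sum over a list, makes splitting and exchanging sums
-- inductions on the dimension; `sumℤ-allVecs` connects the two forms.
∑ : ∀ {n} → (F₂^ n → ℤ) → ℤ
∑ {zero} g = g []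
∑ {suc n} g = ∑ (λ x → g (false ∷ x)) ℤ.+ ∑ (λ x → g (true ∷ x))

∑-cong : ∀ {n} {g h : F₂^ n → ℤ} → (∀ x → g x ≡ h x) → ∑ g ≡ ∑ h
∑-cong {zero} e = e []
∑-cong {suc n} e = cong₂ ℤ._+_ (∑-cong (λ x → e (false ∷ x))) (∑-cong (λ x → e (true ∷ x)))

∑-mono : ∀ {n} {g h : F₂^ n → ℤ} → (∀ x → g x ℤ.≤ h x) → ∑ g ℤ.≤ ∑ h
∑-mono {zero} e = e []
∑-mono {suc n} e = ℤ.+-mono-≤ (∑-mono (λ x → e (false ∷ x))) (∑-mono (λ x → e (true ∷ x)))

∑-+ : ∀ {n} (g h : F₂^ n → ℤ) → ∑ (λ x → g x ℤ.+ h x) ≡ ∑ g ℤ.+ ∑ h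
∑-+ {zero} g h = refl
∑-+ {suc n} g h = trans
  (cong₂ ℤ._+_ (∑-+ (λ x → g (false ∷ x)) (λ x → h (false ∷ x))) (∑-+ (λ x → g (true ∷ x)) (λ x → h (true ∷ x))))
  (interchange (∑ (λ x → g (false ∷ x))) (∑ (λ x → h (false ∷ x))) (∑ (λ x → g (true ∷ x))) (∑ (λ x → h (true ∷ x))))
  where
  interchange : ∀ a b c d → (a ℤ.+ b) ℤ.+ (c ℤ.+ d) ≡ (a ℤ.+ c) ℤ.+ (b ℤ.+ d)
  interchange = solve-∀

∑-*ˡ : ∀ {n} c (g : F₂^ n → ℤ) → ∑ (λ x → c ℤ.* g x) ≡ c ℤ.* ∑ g
∑-*ˡ {zero} c g = refl
∑-*ˡ {suc n} c g = trans (cong₂ ℤ._+_ (∑-*ˡ c (λ x → g (false ∷ x))) (∑-*ˡ c (λ x → g (true ∷ x))))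
  (sym (ℤ.*-distribˡ-+ c (∑ (λ x → g (false ∷ x))) _))

∑-0 : ∀ {n} → ∑ {n} (λ _ → 0ℤ) ≡ 0ℤ
∑-0 {n} = ∑-*ˡ {n} 0ℤ (λ _ → 0ℤ)

∑-1 : ∀ n → ∑ {n} (λ _ → 1ℤ) ≡ + (2 ^ n)
∑-1 zero = refl
∑-1 (suc n) = trans (cong₂ ℤ._+_ (∑-1 n) (∑-1 n)) (cong (λ p → + (2 ^ n + p)) (sym (ℕ.+-identityʳ (2 ^ n))))

∑-swap : ∀ {m n} (g : F₂^ m → F₂^ n → ℤ) → ∑ (λ x → ∑ (g x)) ≡ ∑ (λ y → ∑ (λ x → g x y))
∑-swap {zero} g = refl
∑-swap {suc m} g = trans (cong₂ ℤ._+_ (∑-swap (λ x → g (false ∷ x))) (∑-swap (λ x → g (true ∷ x))))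
  (sym (∑-+ (λ y → ∑ (λ x → g (false ∷ x) y)) (λ y → ∑ (λ x → g (true ∷ x) y))))

∑-++ : ∀ m {n} (g : F₂^ (m + n) → ℤ) → ∑ g ≡ ∑ {m} (λ x → ∑ {n} (λ y → g (x ++ y)))
∑-++ zero g = refl
∑-++ (suc m) g = cong₂ ℤ._+_ (∑-++ m (λ x → g (false ∷ x))) (∑-++ m (λ x → g (true ∷ x)))

∑-bound : ∀ {n} (g : F₂^ n → ℤ) → (∀ x → 0ℤ ℤ.≤ g x) → ∀ x → g x ℤ.≤ ∑ g
∑-bound g nonneg [] = ℤ.≤-refl
∑-bound {suc n} g nonneg (false ∷ x) = ℤ.≤-trans (∑-bound _ (λ x → nonneg (false ∷ x)) x)
  (ℤ.≤-trans (ℤ.≤-reflexive (sym (ℤ.+-identityʳ _)))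
    (ℤ.+-monoʳ-≤ (∑ (λ x → g (false ∷ x))) (ℤ.≤-trans (ℤ.≤-reflexive (sym (∑-0 {n}))) (∑-mono (λ x → nonneg (true ∷ x))))))
∑-bound {suc n} g nonneg (true ∷ x) = ℤ.≤-trans (∑-bound _ (λ x → nonneg (true ∷ x)) x)
  (ℤ.≤-trans (ℤ.≤-reflexive (sym (ℤ.+-identityˡ _)))
    (ℤ.+-monoˡ-≤ (∑ (λ x → g (true ∷ x))) (ℤ.≤-trans (ℤ.≤-reflexive (sym (∑-0 {n}))) (∑-mono (λ x → nonneg (false ∷ x))))))

sumℤ-++ : ∀ xs ys → sumℤ (xs List.++ ys) ≡ sumℤ xs ℤ.+ sumℤ ys
sumℤ-++ List.[] ys = sym (ℤ.+-identityˡ _)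
sumℤ-++ (x List.∷ xs) ys = trans (cong (λ s → x ℤ.+ s) (sumℤ-++ xs ys)) (sym (ℤ.+-assoc x (sumℤ xs) (sumℤ ys)))

sumℤ-allVecs : ∀ n (g : F₂^ n → ℤ) → sumℤ (List.map g (allVecs n)) ≡ ∑ g
sumℤ-allVecs zero g = ℤ.+-identityʳ (g [])
sumℤ-allVecs (suc n) g = begin
  sumℤ (List.map g (List.map (false ∷_) (allVecs n) List.++ List.map (true ∷_) (allVecs n)))
    ≡⟨ cong sumℤ (List.map-++ g (List.map (false ∷_) (allVecs n)) _) ⟩
  sumℤ (List.map g (List.map (false ∷_) (allVecs n)) List.++ List.map g (List.map (true ∷_) (allVecs n)))
    ≡⟨ sumℤ-++ (List.map g (List.map (false ∷_) (allVecs n))) _ ⟩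
  sumℤ (List.map g (List.map (false ∷_) (allVecs n))) ℤ.+ sumℤ (List.map g (List.map (true ∷_) (allVecs n)))
    ≡⟨ cong₂ (λ xs ys → sumℤ xs ℤ.+ sumℤ ys) (List.map-∘ (allVecs n)) (List.map-∘ (allVecs n)) ⟨
  sumℤ (List.map (λ x → g (false ∷ x)) (allVecs n)) ℤ.+ sumℤ (List.map (λ x → g (true ∷ x)) (allVecs n))
    ≡⟨ cong₂ ℤ._+_ (sumℤ-allVecs n _) (sumℤ-allVecs n _) ⟩
  ∑ g ∎
  where open ≡-Reasoning

indicator : Bool → ℤ
indicator b = if b then 1ℤ else 0ℤ

indicator-nonneg : ∀ b → 0ℤ ℤ.≤ indicator b
indicator-nonneg true = +≤+ z≤n
indicator-nonneg false = +≤+ z≤n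

length-filterᵇ : ∀ {A : Set} (p : A → Bool) xs → + length (filterᵇ p xs) ≡ sumℤ (List.map (λ x → indicator (p x)) xs)
length-filterᵇ p List.[] = refl
length-filterᵇ p (x List.∷ xs) with p x
... | true = cong (λ s → 1ℤ ℤ.+ s) (length-filterᵇ p xs)
... | false = trans (length-filterᵇ p xs) (sym (ℤ.+-identityˡ _))

count-allVecs : ∀ n (p : F₂^ n → Bool) → + length (filterᵇ p (allVecs n)) ≡ ∑ (λ x → indicator (p x))
count-allVecs n p = trans (length-filterᵇ p (allVecs n)) (sumℤ-allVecs n _)

-- The indicator of the zero vector, by recursion so that it matches the recursion of `∑`.
δ : ∀ {n} → F₂^ n → ℤ
δ [] = 1ℤ
δ (true ∷ _) = 0ℤ
δ (false ∷ x) = δ x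

δ-𝟎 : ∀ n → δ (𝟎 {n}) ≡ 1ℤ
δ-𝟎 zero = refl
δ-𝟎 (suc n) = δ-𝟎 n

δ-≢𝟎 : ∀ {n} {x : F₂^ n} → x ≢ 𝟎 → δ x ≡ 0ℤ
δ-≢𝟎 {x = []} ne = contradiction refl ne
δ-≢𝟎 {x = true ∷ x} ne = refl
δ-≢𝟎 {x = false ∷ x} ne = δ-≢𝟎 (λ e → ne (cong (false ∷_) e))

δ-nonneg : ∀ {n} (x : F₂^ n) → 0ℤ ℤ.≤ δ x
δ-nonneg [] = +≤+ z≤n
δ-nonneg (true ∷ _) = +≤+ z≤n
δ-nonneg (false ∷ x) = δ-nonneg x

_≟𝟎 : ∀ {n} (x : F₂^ n) → Dec (x ≡ 𝟎)
x ≟𝟎 = ≡-dec Bool._≟_ x 𝟎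

δ-mono : ∀ {m n} {x : F₂^ m} {y : F₂^ n} → (x ≡ 𝟎 → y ≡ 𝟎) → δ x ℤ.≤ δ y
δ-mono {m} {n} {x} {y} to with x ≟𝟎
... | yes refl = ℤ.≤-reflexive (trans (δ-𝟎 m) (sym (trans (cong δ (to refl)) (δ-𝟎 n))))
... | no x≢𝟎 = ℤ.≤-trans (ℤ.≤-reflexive (δ-≢𝟎 x≢𝟎)) (δ-nonneg y)

δ-cong : ∀ {m n} {x : F₂^ m} {y : F₂^ n} → (x ≡ 𝟎 → y ≡ 𝟎) → (y ≡ 𝟎 → x ≡ 𝟎) → δ x ≡ δ y
δ-cong to from = ℤ.≤-antisym (δ-mono to) (δ-mono from)

∑-δ : ∀ {n} (g : F₂^ n → ℤ) c → ∑ (λ x → g x ℤ.* δ (x ⊕ c)) ≡ g c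
∑-δ g [] = ℤ.*-identityʳ (g [])
∑-δ {suc n} g (false ∷ c) = trans (cong₂ ℤ._+_ (∑-δ (λ x → g (false ∷ x)) c)
  (trans (∑-cong (λ x → ℤ.*-zeroʳ (g (true ∷ x)))) (∑-0 {n}))) (ℤ.+-identityʳ _)
∑-δ {suc n} g (true ∷ c) = trans (cong₂ ℤ._+_
  (trans (∑-cong (λ x → ℤ.*-zeroʳ (g (false ∷ x)))) (∑-0 {n})) (∑-δ (λ x → g (true ∷ x)) c)) (ℤ.+-identityˡ _)

-- Orthogonality of characters: a coordinate 1 in c makes the two halves of the sum cancel, and for
-- c = 0 every term is 1.
∑-sgn : ∀ {n} (c : F₂^ n) → ∑ (λ x → sgn ⟨ x , c ⟩) ≡ + (2 ^ n) ℤ.* δ c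
∑-sgn [] = refl
∑-sgn {suc n} (false ∷ c) = trans (cong₂ ℤ._+_ (∑-sgn c) (∑-sgn c))
  (trans (sym (ℤ.*-distribʳ-+ (δ c) (+ (2 ^ n)) (+ (2 ^ n)))) (cong (λ p → + (2 ^ n + p) ℤ.* δ c) (sym (ℕ.+-identityʳ (2 ^ n)))))
∑-sgn {suc n} (true ∷ c) = begin
  S ℤ.+ ∑ (λ x → sgn (true xor ⟨ x , c ⟩)) ≡⟨ cong (λ s → S ℤ.+ s) (trans (∑-cong (λ x → sgn-xor true ⟨ x , c ⟩)) (∑-*ˡ -1ℤ (λ x → sgn ⟨ x , c ⟩))) ⟩
  S ℤ.+ -1ℤ ℤ.* S ≡⟨ cancel S ⟩
  0ℤ ≡⟨ ℤ.*-zeroʳ (+ (2 ^ suc n)) ⟨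
  + (2 ^ suc n) ℤ.* 0ℤ ∎
  where
  open ≡-Reasoning
  S = ∑ (λ x → sgn ⟨ x , c ⟩)
  cancel : ∀ s → s ℤ.+ -1ℤ ℤ.* s ≡ 0ℤ
  cancel = solve-∀

take-++ : ∀ {A : Set} {m n} (x : Vec A m) (y : Vec A n) → take m (x ++ y) ≡ x
take-++ {m = m} x y = ++-injectiveˡ _ x (take++drop≡id m (x ++ y))

drop-++ : ∀ {A : Set} {m n} (x : Vec A m) (y : Vec A n) → drop m (x ++ y) ≡ y
drop-++ {m = m} x y = ++-injectiveʳ (take m (x ++ y)) x (take++drop≡id m (x ++ y))

𝟎-++ : ∀ m {n} → 𝟎 {m} ++ 𝟎 {n} ≡ 𝟎 {m + n}
𝟎-++ zero = refl
𝟎-++ (suc m) = cong (false ∷_) (𝟎-++ m)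

-- Padding with zeros is the adjoint of truncation.
⟨⟩-take : ∀ m {n} (u : F₂^ m) (x : F₂^ (m + n)) → ⟨ u ++ 𝟎 , x ⟩ ≡ ⟨ u , take m x ⟩
⟨⟩-take m u x = begin
  ⟨ u ++ 𝟎 , x ⟩ ≡⟨ cong ⟨ u ++ 𝟎 ,_⟩ (take++drop≡id m x) ⟨
  ⟨ u ++ 𝟎 , take m x ++ drop m x ⟩ ≡⟨ ⟨⟩-++ u (take m x) ⟩
  ⟨ u , take m x ⟩ xor ⟨ 𝟎 , drop m x ⟩ ≡⟨ cong (⟨ u , take m x ⟩ xor_) (⟨⟩-𝟎ˡ (drop m x)) ⟩
  ⟨ u , take m x ⟩ xor false ≡⟨ Bool.xor-identityʳ _ ⟩
  ⟨ u , take m x ⟩ ∎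
  where open ≡-Reasoning

sgn-*-≤ : ∀ b {i} → 0ℤ ℤ.≤ i → sgn b ℤ.* i ℤ.≤ i
sgn-*-≤ false {i} _ = ℤ.≤-reflexive (ℤ.*-identityˡ i)
sgn-*-≤ true {+ zero} _ = +≤+ z≤n
sgn-*-≤ true {+ suc n} _ = ℤ.-≤+

sgn≢0 : ∀ b → sgn b ≢ 0ℤ
sgn≢0 false ()
sgn≢0 true ()

pow≢0 : ∀ n → + (2 ^ n) ≢ 0ℤ
pow≢0 n e = ℕ.<⇒≢ (ℕ.m^n>0 2 n) (sym (ℤ.+-injective e))

*-≢0 : ∀ {i j} → i ≢ 0ℤ → j ≢ 0ℤ → i ℤ.* j ≢ 0ℤ
*-≢0 {i} i≢0 j≢0 e with ℤ.i*j≡0⇒i≡0∨j≡0 i e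
... | inj₁ i≡0 = i≢0 i≡0
... | inj₂ j≡0 = j≢0 j≡0

*-*-zeroʳ : ∀ {a b d x} → x ≡ a ℤ.* (b ℤ.* d) → d ≡ 0ℤ → x ≡ 0ℤ
*-*-zeroʳ {a} {b} e refl = trans e (trans (cong (a ℤ.*_) (ℤ.*-zeroʳ b)) (ℤ.*-zeroʳ a))

δ-self≢0 : ∀ {n} (x : F₂^ n) → δ (x ⊕ x) ≢ 0ℤ
δ-self≢0 {n} x e with trans (sym (trans (cong δ (⊕-self x)) (δ-𝟎 n))) e
... | ()

*-nonneg : ∀ {i j} → 0ℤ ℤ.≤ i → 0ℤ ℤ.≤ j → 0ℤ ℤ.≤ i ℤ.* j
*-nonneg {+ m} {+ n} _ _ = subst (0ℤ ℤ.≤_) (ℤ.pos-* m n) (+≤+ z≤n)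

∧-true : ∀ {a b} → a ∧ b ≡ true → a ≡ true × b ≡ true
∧-true {true} {true} _ = refl , refl

indicator-≤ : ∀ b {i} → 0ℤ ℤ.≤ i → (b ≡ true → i ≡ 1ℤ) → indicator b ℤ.≤ i
indicator-≤ false 0≤i _ = 0≤i
indicator-≤ true _ i≡1 = ℤ.≤-reflexive (sym (i≡1 refl))

-- 2^D δ(z t) = Σ_u (-1)^⟨u, z t⟩, and summing over t first leaves only the term u = 0.
∑-δ-affine : ∀ {M D} (z : F₂^ M → F₂^ D) (c : F₂^ D → Bool) (q : F₂^ D → F₂^ M) →
  (∀ u t → ⟨ u , z t ⟩ ≡ c u xor ⟨ t , q u ⟩) → (∀ u → q u ≡ 𝟎 → u ≡ 𝟎) →
  + (2 ^ D) ℤ.* ∑ (λ t → δ (z t)) ℤ.≤ + (2 ^ M)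
∑-δ-affine {M} {D} z c q adj inj = begin
  + (2 ^ D) ℤ.* ∑ (λ t → δ (z t))
    ≡⟨ ∑-*ˡ (+ (2 ^ D)) (λ t → δ (z t)) ⟨
  ∑ (λ t → + (2 ^ D) ℤ.* δ (z t))
    ≡⟨ ∑-cong (λ t → sym (∑-sgn (z t))) ⟩
  ∑ (λ t → ∑ (λ u → sgn ⟨ u , z t ⟩))
    ≡⟨ ∑-swap (λ t u → sgn ⟨ u , z t ⟩) ⟩
  ∑ (λ u → ∑ (λ t → sgn ⟨ u , z t ⟩))
    ≡⟨ ∑-cong (λ u → trans (∑-cong (λ t → trans (cong sgn (adj u t)) (sgn-xor (c u) _)))
         (trans (∑-*ˡ (sgn (c u)) (λ t → sgn ⟨ t , q u ⟩)) (cong (sgn (c u) ℤ.*_) (∑-sgn (q u))))) ⟩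
  ∑ (λ u → sgn (c u) ℤ.* (+ (2 ^ M) ℤ.* δ (q u)))
    ≤⟨ ∑-mono (λ u → ℤ.≤-trans
         (sgn-*-≤ (c u) (ℤ.≤-trans (ℤ.≤-reflexive (sym (ℤ.*-zeroʳ (+ (2 ^ M)))))
           (ℤ.*-monoˡ-≤-nonNeg (+ (2 ^ M)) (δ-nonneg (q u)))))
         (ℤ.*-monoˡ-≤-nonNeg (+ (2 ^ M)) (δ-mono (λ e → trans (⊕-identityʳ u) (inj u e))))) ⟩
  ∑ {D} (λ u → + (2 ^ M) ℤ.* δ (u ⊕ 𝟎))
    ≡⟨ ∑-δ {D} (λ _ → + (2 ^ M)) 𝟎 ⟩
  + (2 ^ M) ∎
  where open ℤ.≤-Reasoning

-- Field multiplication and division on coordinate vectors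

module Multiplication {m : ℕ} (F : BinaryField m) where
  open BinaryField F

  infixl 21 _⋆_ _÷_

  _⋆_ : F₂^ m → F₂^ m → F₂^ m
  x ⋆ y = toVec (fromVec x ⊠ fromVec y)

  _÷_ : F₂^ m → F₂^ m → F₂^ m
  x ÷ y with invert (fromVec y)
  -- A default for division by 0; the laws of division below assume a nonzero divisor.
  ... | inj₁ _ = 𝟎
  ... | inj₂ (y⁻¹ , _) = toVec (fromVec x ⊠ y⁻¹)

  fromVec-⊕ : ∀ x y → fromVec (x ⊕ y) ≡ fromVec x ⊞ fromVec y
  fromVec-⊕ x y = begin
    fromVec (x ⊕ y) ≡⟨ cong₂ (λ a b → fromVec (a ⊕ b)) (to∘from x) (to∘from y) ⟨
    fromVec (toVec (fromVec x) ⊕ toVec (fromVec y)) ≡⟨ cong fromVec (toVec-⊞ _ _) ⟨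
    fromVec (toVec (fromVec x ⊞ fromVec y)) ≡⟨ from∘to _ ⟩
    fromVec x ⊞ fromVec y ∎
    where open ≡-Reasoning

  toVec-0K : toVec 0K ≡ 𝟎
  toVec-0K = trans (cong toVec (sym (char2 0K))) (trans (toVec-⊞ 0K 0K) (⊕-self (toVec 0K)))

  fromVec≡0K : ∀ {x} → fromVec x ≡ 0K → x ≡ 𝟎
  fromVec≡0K {x} e = trans (sym (to∘from x)) (trans (cong toVec e) toVec-0K)

  ⋆-⊕ˡ : ∀ x y z → (x ⊕ y) ⋆ z ≡ x ⋆ z ⊕ y ⋆ z
  ⋆-⊕ˡ x y z = trans (cong toVec (trans (cong (_⊠ fromVec z) (fromVec-⊕ x y)) (distribʳ _ _ _))) (toVec-⊞ _ _)

  ⋆-⊕ʳ : ∀ x y z → x ⋆ (y ⊕ z) ≡ x ⋆ y ⊕ x ⋆ z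
  ⋆-⊕ʳ x y z = trans (cong toVec (trans (cong (fromVec x ⊠_) (fromVec-⊕ y z)) (distribˡ _ _ _))) (toVec-⊞ _ _)

  ÷-⋆ : ∀ x {y} → y ≢ 𝟎 → (x ÷ y) ⋆ y ≡ x
  ÷-⋆ x {y} y≢𝟎 with invert (fromVec y)
  ... | inj₁ e = contradiction (fromVec≡0K e) y≢𝟎
  ... | inj₂ (y⁻¹ , e) = begin
    toVec (fromVec (toVec (fromVec x ⊠ y⁻¹)) ⊠ fromVec y) ≡⟨ cong (λ a → toVec (a ⊠ fromVec y)) (from∘to _) ⟩
    toVec (fromVec x ⊠ y⁻¹ ⊠ fromVec y) ≡⟨ cong toVec (trans (*-assoc _ _ _) (cong (fromVec x ⊠_) (trans (*-comm _ _) e))) ⟩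
    toVec (fromVec x ⊠ 1K) ≡⟨ cong toVec (*-identityʳ _) ⟩
    toVec (fromVec x) ≡⟨ to∘from x ⟩
    x ∎
    where open ≡-Reasoning

  ⋆-÷ : ∀ x {y} → y ≢ 𝟎 → (x ⋆ y) ÷ y ≡ x
  ⋆-÷ x {y} y≢𝟎 with invert (fromVec y)
  ... | inj₁ e = contradiction (fromVec≡0K e) y≢𝟎
  ... | inj₂ (y⁻¹ , e) = begin
    toVec (fromVec (toVec (fromVec x ⊠ fromVec y)) ⊠ y⁻¹) ≡⟨ cong (λ a → toVec (a ⊠ y⁻¹)) (from∘to _) ⟩
    toVec (fromVec x ⊠ fromVec y ⊠ y⁻¹) ≡⟨ cong toVec (trans (*-assoc _ _ _) (cong (fromVec x ⊠_) e)) ⟩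
    toVec (fromVec x ⊠ 1K) ≡⟨ cong toVec (*-identityʳ _) ⟩
    toVec (fromVec x) ≡⟨ to∘from x ⟩
    x ∎
    where open ≡-Reasoning

  -- There are no zero divisors, since division by y recovers x. This is what bounds the rank of the
  -- derivative of `Q` from below.
  ⋆≡𝟎 : ∀ x {y} → y ≢ 𝟎 → x ⋆ y ≡ 𝟎 → x ≡ 𝟎
  ⋆≡𝟎 x {y} y≢𝟎 e = trans (sym (⋆-÷ x y≢𝟎)) (trans (cong (_÷ y) e) 𝟎÷)
    where
    𝟎÷ : 𝟎 ÷ y ≡ 𝟎
    𝟎÷ = trans (cong (_÷ y) (sym 𝟎⋆)) (⋆-÷ 𝟎 y≢𝟎)
      where
      𝟎⋆ : 𝟎 ⋆ y ≡ 𝟎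
      𝟎⋆ = trans (cong (_⋆ y) (sym (⊕-self 𝟎))) (trans (⋆-⊕ˡ 𝟎 𝟎 y) (⊕-self (𝟎 ⋆ y)))

not-isYes-≟ : ∀ {i : ℤ} → not (isYes (i ℤ.≟ 0ℤ)) ≡ true → i ≢ 0ℤ
not-isYes-≟ {i} e with i ℤ.≟ 0ℤ
... | no i≢0 = i≢0

≢0⇒not-isYes : ∀ {i : ℤ} → i ≢ 0ℤ → not (isYes (i ℤ.≟ 0ℤ)) ≡ true
≢0⇒not-isYes {i} i≢0 with i ℤ.≟ 0ℤ
... | yes i≡0 = contradiction i≡0 i≢0
... | no _ = refl

-- The function f and its Fourier support

-- Injectivity of ι on the first D coordinates provides the rank D; the r further coordinates let
-- the dimension be adjusted to the prescribed n.
module Construction {E D r : ℕ} (F : BinaryField E) (s₀ : F₂^ E) (ι : F₂^ (D + r) → F₂^ E)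
  (ι-⊕ : ∀ x y → ι (x ⊕ y) ≡ ι x ⊕ ι y) (s₀⊕ι≢𝟎 : ∀ w → s₀ ⊕ ι w ≢ 𝟎)
  (ι-injective : ∀ (u : F₂^ D) → ι (u ++ 𝟎) ≡ 𝟎 → u ≡ 𝟎) where
  open Multiplication F

  T : ℕ
  T = D + r

  -- A point is read as (v, y, w), in blocks of E, E and T coordinates. For fixed w this is a
  -- Maiorana-McFarland bent function of (v, y), because v ↦ v / s(w) is a permutation.
  f : F₂^ ((E + E) + T) → ℤ
  f x = sgn ⟨ drop E (take (E + E) x) , take E (take (E + E) x) ÷ (s₀ ⊕ ι (drop (E + E) x)) ⟩

  -- Here t = (ν, α) collects the frequencies dual to v and y; the vector represents the linear form
  -- in w that remains once v and y have been summed out.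
  Q : F₂^ (E + E) → F₂^ T
  Q t = dual (λ w → ⟨ drop E t ⋆ ι w , take E t ⟩)

  ⟨⟩-Q : ∀ w t → ⟨ w , Q t ⟩ ≡ ⟨ drop E t ⋆ ι w , take E t ⟩
  ⟨⟩-Q w t = ⟨⟩-dual (λ w → ⟨ drop E t ⋆ ι w , take E t ⟩) additive w
    where
    additive : Additive (λ w → ⟨ drop E t ⋆ ι w , take E t ⟩)
    additive x y = trans
      (cong ⟨_, take E t ⟩ (trans (cong (drop E t ⋆_) (ι-⊕ x y)) (⋆-⊕ʳ (drop E t) (ι x) (ι y))))
      (⟨⟩-⊕ˡ (drop E t ⋆ ι x) (drop E t ⋆ ι y) (take E t))

  f-++ : ∀ v y w → f ((v ++ y) ++ w) ≡ sgn ⟨ y , v ÷ (s₀ ⊕ ι w) ⟩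
  f-++ v y w rewrite take-++ (v ++ y) w | drop-++ (v ++ y) w | take-++ v y | drop-++ v y = refl

  f-isSign : IsSignFunction f
  f-isSign x with ⟨ drop E (take (E + E) x) , take E (take (E + E) x) ÷ (s₀ ⊕ ι (drop (E + E) x)) ⟩
  ... | true = inj₂ refl
  ... | false = inj₁ refl

  -- The factor 2^E comes from the sum over y, the sign from the constant part s₀ of s(w).
  amplitude : F₂^ (E + E) → ℤ
  amplitude t = + (2 ^ E) ℤ.* sgn ⟨ drop E t ⋆ s₀ , take E t ⟩

  -- The sum over y forces v / s(w) = α, so the sum over v reduces to v = α s(w). Expanding s(w) =
  -- s₀ + ι(w) separates the constant sign from the character ⟨w, Q t⟩, and the sum over w then
  -- vanishes unless μ = Q t.
  fourier-f : ∀ t μ → fourierSum f (t ++ μ) ≡ amplitude t ℤ.* (+ (2 ^ T) ℤ.* δ (μ ⊕ Q t))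
  fourier-f t μ = begin
    fourierSum f (t ++ μ)
      ≡⟨ cong (λ t → fourierSum f (t ++ μ)) (take++drop≡id E t) ⟨
    fourierSum f ((ν ++ α) ++ μ)
      ≡⟨ sumℤ-allVecs ((E + E) + T) (λ x → f x ℤ.* χ ((ν ++ α) ++ μ) x) ⟩
    ∑ {(E + E) + T} (λ x → f x ℤ.* χ ((ν ++ α) ++ μ) x)
      ≡⟨ trans (∑-++ (E + E) (λ x → f x ℤ.* χ ((ν ++ α) ++ μ) x))
           (∑-++ E (λ t → ∑ (λ w → f (t ++ w) ℤ.* χ ((ν ++ α) ++ μ) (t ++ w)))) ⟩
    ∑ {E} (λ v → ∑ {E} (λ y → ∑ {T} (λ w → f ((v ++ y) ++ w) ℤ.* χ ((ν ++ α) ++ μ) ((v ++ y) ++ w))))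
      ≡⟨ ∑-cong (λ v → ∑-cong (λ y → ∑-cong (λ w → summand v y w))) ⟩
    ∑ (λ v → ∑ (λ y → ∑ (λ w → h v w ℤ.* sgn ⟨ y , (v ÷ s w) ⊕ α ⟩)))
      ≡⟨ ∑-cong (λ v → ∑-swap (λ y w → h v w ℤ.* sgn ⟨ y , (v ÷ s w) ⊕ α ⟩)) ⟩
    ∑ (λ v → ∑ (λ w → ∑ (λ y → h v w ℤ.* sgn ⟨ y , (v ÷ s w) ⊕ α ⟩)))
      ≡⟨ ∑-swap (λ v w → ∑ (λ y → h v w ℤ.* sgn ⟨ y , (v ÷ s w) ⊕ α ⟩)) ⟩
    ∑ (λ w → ∑ (λ v → ∑ (λ y → h v w ℤ.* sgn ⟨ y , (v ÷ s w) ⊕ α ⟩)))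
      ≡⟨ ∑-cong (λ w → ∑-cong (λ v → sum-y v w)) ⟩
    ∑ (λ w → ∑ (λ v → (sgn ⟨ w , μ ⟩ ℤ.* + (2 ^ E)) ℤ.* (sgn ⟨ v , ν ⟩ ℤ.* δ (v ⊕ (α ⋆ s w)))))
      ≡⟨ ∑-cong sum-v ⟩
    ∑ (λ w → amplitude t ℤ.* sgn ⟨ w , μ ⊕ Q t ⟩)
      ≡⟨ ∑-*ˡ (amplitude t) (λ w → sgn ⟨ w , μ ⊕ Q t ⟩) ⟩
    amplitude t ℤ.* ∑ (λ w → sgn ⟨ w , μ ⊕ Q t ⟩)
      ≡⟨ cong (amplitude t ℤ.*_) (∑-sgn (μ ⊕ Q t)) ⟩
    amplitude t ℤ.* (+ (2 ^ T) ℤ.* δ (μ ⊕ Q t)) ∎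
    where
    open ≡-Reasoning
    open xor-∧-Solver using (solve; _:+_; _:=_)
    ν = take E t
    α = drop E t

    s : F₂^ T → F₂^ E
    s w = s₀ ⊕ ι w

    h : F₂^ E → F₂^ T → ℤ
    h v w = sgn ⟨ v , ν ⟩ ℤ.* sgn ⟨ w , μ ⟩

    summand : ∀ v y w → f ((v ++ y) ++ w) ℤ.* χ ((ν ++ α) ++ μ) ((v ++ y) ++ w) ≡
      h v w ℤ.* sgn ⟨ y , (v ÷ s w) ⊕ α ⟩
    summand v y w = begin
      f ((v ++ y) ++ w) ℤ.* sgn ⟨ (v ++ y) ++ w , (ν ++ α) ++ μ ⟩
        ≡⟨ cong₂ ℤ._*_ (f-++ v y w) (cong sgn (trans (⟨⟩-++ (v ++ y) (ν ++ α)) (cong (_xor ⟨ w , μ ⟩) (⟨⟩-++ v ν)))) ⟩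
      sgn ⟨ y , v ÷ s w ⟩ ℤ.* sgn ((⟨ v , ν ⟩ xor ⟨ y , α ⟩) xor ⟨ w , μ ⟩)
        ≡⟨ sgn-xor ⟨ y , v ÷ s w ⟩ _ ⟨
      sgn (⟨ y , v ÷ s w ⟩ xor ((⟨ v , ν ⟩ xor ⟨ y , α ⟩) xor ⟨ w , μ ⟩))
        ≡⟨ cong sgn (solve 4 (λ a b c d → a :+ ((b :+ c) :+ d) := (b :+ d) :+ (a :+ c)) refl
             ⟨ y , v ÷ s w ⟩ ⟨ v , ν ⟩ ⟨ y , α ⟩ ⟨ w , μ ⟩) ⟩
      sgn ((⟨ v , ν ⟩ xor ⟨ w , μ ⟩) xor (⟨ y , v ÷ s w ⟩ xor ⟨ y , α ⟩))
        ≡⟨ sgn-xor (⟨ v , ν ⟩ xor ⟨ w , μ ⟩) _ ⟩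
      sgn (⟨ v , ν ⟩ xor ⟨ w , μ ⟩) ℤ.* sgn (⟨ y , v ÷ s w ⟩ xor ⟨ y , α ⟩)
        ≡⟨ cong₂ ℤ._*_ (sgn-xor ⟨ v , ν ⟩ _) (cong sgn (sym (⟨⟩-⊕ʳ y (v ÷ s w) α))) ⟩
      h v w ℤ.* sgn ⟨ y , (v ÷ s w) ⊕ α ⟩ ∎

    δ-quotient : ∀ v w → δ ((v ÷ s w) ⊕ α) ≡ δ (v ⊕ (α ⋆ s w))
    δ-quotient v w = δ-cong
      (λ e → trans (cong (_⊕ (α ⋆ s w)) (trans (sym (÷-⋆ v (s₀⊕ι≢𝟎 w))) (cong (_⋆ s w) (⊕-≡𝟎 e)))) (⊕-self _))
      (λ e → trans (cong (λ v → (v ÷ s w) ⊕ α) (⊕-≡𝟎 e)) (trans (cong (_⊕ α) (⋆-÷ α (s₀⊕ι≢𝟎 w))) (⊕-self α)))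

    rearrange : ∀ a b c d → (a ℤ.* b) ℤ.* (c ℤ.* d) ≡ (b ℤ.* c) ℤ.* (a ℤ.* d)
    rearrange = solve-∀

    sum-y : ∀ v w → ∑ (λ y → h v w ℤ.* sgn ⟨ y , (v ÷ s w) ⊕ α ⟩) ≡
      (sgn ⟨ w , μ ⟩ ℤ.* + (2 ^ E)) ℤ.* (sgn ⟨ v , ν ⟩ ℤ.* δ (v ⊕ (α ⋆ s w)))
    sum-y v w = begin
      ∑ (λ y → h v w ℤ.* sgn ⟨ y , (v ÷ s w) ⊕ α ⟩)
        ≡⟨ ∑-*ˡ (h v w) (λ y → sgn ⟨ y , (v ÷ s w) ⊕ α ⟩) ⟩
      h v w ℤ.* ∑ (λ y → sgn ⟨ y , (v ÷ s w) ⊕ α ⟩)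
        ≡⟨ cong (h v w ℤ.*_) (trans (∑-sgn ((v ÷ s w) ⊕ α)) (cong (+ (2 ^ E) ℤ.*_) (δ-quotient v w))) ⟩
      h v w ℤ.* (+ (2 ^ E) ℤ.* δ (v ⊕ (α ⋆ s w)))
        ≡⟨ rearrange (sgn ⟨ v , ν ⟩) (sgn ⟨ w , μ ⟩) (+ (2 ^ E)) (δ (v ⊕ (α ⋆ s w))) ⟩
      (sgn ⟨ w , μ ⟩ ℤ.* + (2 ^ E)) ℤ.* (sgn ⟨ v , ν ⟩ ℤ.* δ (v ⊕ (α ⋆ s w))) ∎

    sum-v : ∀ w → ∑ (λ v → (sgn ⟨ w , μ ⟩ ℤ.* + (2 ^ E)) ℤ.* (sgn ⟨ v , ν ⟩ ℤ.* δ (v ⊕ (α ⋆ s w)))) ≡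
      amplitude t ℤ.* sgn ⟨ w , μ ⊕ Q t ⟩
    sum-v w = begin
      ∑ (λ v → (sgn ⟨ w , μ ⟩ ℤ.* + (2 ^ E)) ℤ.* (sgn ⟨ v , ν ⟩ ℤ.* δ (v ⊕ (α ⋆ s w))))
        ≡⟨ ∑-*ˡ (sgn ⟨ w , μ ⟩ ℤ.* + (2 ^ E)) (λ v → sgn ⟨ v , ν ⟩ ℤ.* δ (v ⊕ (α ⋆ s w))) ⟩
      (sgn ⟨ w , μ ⟩ ℤ.* + (2 ^ E)) ℤ.* ∑ (λ v → sgn ⟨ v , ν ⟩ ℤ.* δ (v ⊕ (α ⋆ s w)))
        ≡⟨ cong ((sgn ⟨ w , μ ⟩ ℤ.* + (2 ^ E)) ℤ.*_) (∑-δ (λ v → sgn ⟨ v , ν ⟩) (α ⋆ s w)) ⟩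
      (sgn ⟨ w , μ ⟩ ℤ.* + (2 ^ E)) ℤ.* sgn ⟨ α ⋆ s w , ν ⟩
        ≡⟨ cong ((sgn ⟨ w , μ ⟩ ℤ.* + (2 ^ E)) ℤ.*_) (trans
             (cong sgn (trans (cong ⟨_, ν ⟩ (⋆-⊕ʳ α s₀ (ι w))) (⟨⟩-⊕ˡ (α ⋆ s₀) (α ⋆ ι w) ν)))
             (sgn-xor ⟨ α ⋆ s₀ , ν ⟩ _)) ⟩
      (sgn ⟨ w , μ ⟩ ℤ.* + (2 ^ E)) ℤ.* (sgn ⟨ α ⋆ s₀ , ν ⟩ ℤ.* sgn ⟨ α ⋆ ι w , ν ⟩)
        ≡⟨ rearrange (sgn ⟨ w , μ ⟩) (+ (2 ^ E)) (sgn ⟨ α ⋆ s₀ , ν ⟩) (sgn ⟨ α ⋆ ι w , ν ⟩) ⟩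
      amplitude t ℤ.* (sgn ⟨ w , μ ⟩ ℤ.* sgn ⟨ α ⋆ ι w , ν ⟩)
        ≡⟨ cong (amplitude t ℤ.*_) (trans (sym (sgn-xor ⟨ w , μ ⟩ _))
             (cong sgn (trans (cong (⟨ w , μ ⟩ xor_) (sym (⟨⟩-Q w t))) (sym (⟨⟩-⊕ʳ w μ (Q t)))))) ⟩
      amplitude t ℤ.* sgn ⟨ w , μ ⊕ Q t ⟩ ∎

  amplitude≢0 : ∀ t → amplitude t ≢ 0ℤ
  amplitude≢0 t = *-≢0 (pow≢0 E) (sgn≢0 ⟨ drop E t ⋆ s₀ , take E t ⟩)

  inSupp⇒Q : ∀ t μ → inSupp f (t ++ μ) ≡ true → μ ≡ Q t
  inSupp⇒Q t μ e with (μ ⊕ Q t) ≟𝟎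
  ... | yes μ⊕Q≡𝟎 = ⊕-≡𝟎 μ⊕Q≡𝟎
  ... | no μ⊕Q≢𝟎 = contradiction
    (*-*-zeroʳ {amplitude t} {+ (2 ^ T)} (fourier-f t μ) (δ-≢𝟎 μ⊕Q≢𝟎))
    (not-isYes-≟ {fourierSum f (t ++ μ)} e)

  Q⇒inSupp : ∀ t → inSupp f (t ++ Q t) ≡ true
  Q⇒inSupp t = ≢0⇒not-isYes {fourierSum f (t ++ Q t)} (λ e → *-≢0 (amplitude≢0 t) (*-≢0 (pow≢0 T) (δ-self≢0 (Q t)))
    (trans (sym (fourier-f t (Q t))) e))

  -- Each of the 2^(2E) fibres over t contains the support point (t, Q t).
  suppSize-f : 2 ^ (E + E) ≤ suppSize f
  suppSize-f = ℤ.drop‿+≤+ (begin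
    + (2 ^ (E + E)) ≡⟨ ∑-1 (E + E) ⟨
    ∑ {E + E} (λ t → 1ℤ)
      ≤⟨ ∑-mono (λ t → ℤ.≤-trans (ℤ.≤-reflexive (cong indicator (sym (Q⇒inSupp t))))
           (∑-bound (λ μ → indicator (inSupp f (t ++ μ))) (λ μ → indicator-nonneg _) (Q t))) ⟩
    ∑ {E + E} (λ t → ∑ {T} (λ μ → indicator (inSupp f (t ++ μ))))
      ≡⟨ ∑-++ (E + E) (λ x → indicator (inSupp f x)) ⟨
    ∑ {(E + E) + T} (λ x → indicator (inSupp f x)) ≡⟨ count-allVecs ((E + E) + T) (inSupp f) ⟨
    + suppSize f ∎)
    where open ℤ.≤-Reasoning

  -- The intersection of two shifts of the graph

  module _ (τ₁ τ₂ : F₂^ (E + E)) (μ₁ μ₂ : F₂^ T) where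
    private
      ν₁ ν₂ α₁ α₂ : F₂^ E
      ν₁ = take E τ₁
      ν₂ = take E τ₂
      α₁ = drop E τ₁
      α₂ = drop E τ₂

      both : F₂^ ((E + E) + T) → Bool
      both x = inSupp f (x ⊕ (τ₁ ++ μ₁)) ∧ inSupp f (x ⊕ (τ₂ ++ μ₂))

      inSupp-shift : ∀ t μ τ ρ → inSupp f ((t ++ μ) ⊕ (τ ++ ρ)) ≡ true → μ ⊕ ρ ≡ Q (t ⊕ τ)
      inSupp-shift t μ τ ρ e = inSupp⇒Q (t ⊕ τ) (μ ⊕ ρ)
        (trans (cong (inSupp f) (sym (zipWith-++ _xor_ t μ τ ρ))) e)

      both⇒Q : ∀ t μ → both (t ++ μ) ≡ true → (μ ⊕ μ₁ ≡ Q (t ⊕ τ₁)) × (μ ⊕ μ₂ ≡ Q (t ⊕ τ₂))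
      both⇒Q t μ e = inSupp-shift t μ τ₁ μ₁ (proj₁ (∧-true e)) ,
        inSupp-shift t μ τ₂ μ₂ (proj₂ (∧-true {inSupp f ((t ++ μ) ⊕ (τ₁ ++ μ₁))} e))

      -- A common point (t, μ) of the shifts satisfies μ = Q(t + τ₁) + μ₁ = Q(t + τ₂) + μ₂; this is
      -- the difference of the two values.
      derivative : F₂^ (E + E) → F₂^ T
      derivative t = (Q (t ⊕ τ₁) ⊕ Q (t ⊕ τ₂)) ⊕ (μ₁ ⊕ μ₂)

      both⇒derivative≡𝟎 : ∀ t μ → both (t ++ μ) ≡ true → derivative t ≡ 𝟎
      both⇒derivative≡𝟎 t μ e = begin
        (Q (t ⊕ τ₁) ⊕ Q (t ⊕ τ₂)) ⊕ (μ₁ ⊕ μ₂)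
          ≡⟨ sym (cong₂ (λ a b → (a ⊕ b) ⊕ (μ₁ ⊕ μ₂)) (proj₁ (both⇒Q t μ e)) (proj₂ (both⇒Q t μ e))) ⟩
        ((μ ⊕ μ₁) ⊕ (μ ⊕ μ₂)) ⊕ (μ₁ ⊕ μ₂)
          ≡⟨ cong (λ a → (a ⊕ (μ ⊕ μ₂)) ⊕ (μ₁ ⊕ μ₂)) (⊕-comm μ μ₁) ⟩
        ((μ₁ ⊕ μ) ⊕ (μ ⊕ μ₂)) ⊕ (μ₁ ⊕ μ₂)
          ≡⟨ cong (_⊕ (μ₁ ⊕ μ₂)) (trans (⊕-assoc μ₁ μ (μ ⊕ μ₂)) (cong (μ₁ ⊕_) (⊕-cancel μ μ₂))) ⟩
        (μ₁ ⊕ μ₂) ⊕ (μ₁ ⊕ μ₂) ≡⟨ ⊕-self (μ₁ ⊕ μ₂) ⟩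
        𝟎 ∎
        where open ≡-Reasoning

      both⇒offset : ∀ t μ → both (t ++ μ) ≡ true → μ ⊕ (Q (t ⊕ τ₁) ⊕ μ₁) ≡ 𝟎
      both⇒offset t μ e = begin
        μ ⊕ (Q (t ⊕ τ₁) ⊕ μ₁) ≡⟨ sym (cong (λ a → μ ⊕ (a ⊕ μ₁)) (proj₁ (both⇒Q t μ e))) ⟩
        μ ⊕ ((μ ⊕ μ₁) ⊕ μ₁) ≡⟨ cong (μ ⊕_) (⊕-assoc μ μ₁ μ₁) ⟩
        μ ⊕ (μ ⊕ (μ₁ ⊕ μ₁)) ≡⟨ ⊕-cancel μ (μ₁ ⊕ μ₁) ⟩
        μ₁ ⊕ μ₁ ≡⟨ ⊕-self μ₁ ⟩
        𝟎 ∎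
        where open ≡-Reasoning

      count-both : + shiftInterSize f (τ₁ ++ μ₁) (τ₂ ++ μ₂) ≡ ∑ {E + E} (λ t → ∑ {T} (λ μ → indicator (both (t ++ μ))))
      count-both = trans (count-allVecs ((E + E) + T) both) (∑-++ (E + E) (λ x → indicator (both x)))

      -- A common point over t has its μ determined by t, and requires the derivative to vanish at
      -- t. Keeping only the first D coordinates of the derivative weakens the condition to the part
      -- on which ι is injective.
      count-≤ : + shiftInterSize f (τ₁ ++ μ₁) (τ₂ ++ μ₂) ℤ.≤ ∑ (λ t → δ (take D (derivative t)))
      count-≤ = ℤ.≤-trans (ℤ.≤-reflexive count-both) (∑-mono (λ t → ℤ.≤-trans
        (∑-mono (λ μ → indicator-≤ (both (t ++ μ)) (nonneg t μ) (one t μ)))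
        (ℤ.≤-reflexive (∑-δ (λ _ → δ (take D (derivative t))) (Q (t ⊕ τ₁) ⊕ μ₁)))))
        where
        nonneg : ∀ t μ → 0ℤ ℤ.≤ δ (take D (derivative t)) ℤ.* δ (μ ⊕ (Q (t ⊕ τ₁) ⊕ μ₁))
        nonneg t μ = *-nonneg (δ-nonneg (take D (derivative t))) (δ-nonneg (μ ⊕ (Q (t ⊕ τ₁) ⊕ μ₁)))

        take-𝟎 : take D (𝟎 {T}) ≡ 𝟎
        take-𝟎 = trans (cong (take D) (sym (𝟎-++ D))) (take-++ (𝟎 {D}) 𝟎)

        one : ∀ t μ → both (t ++ μ) ≡ true → δ (take D (derivative t)) ℤ.* δ (μ ⊕ (Q (t ⊕ τ₁) ⊕ μ₁)) ≡ 1ℤ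
        one t μ e = cong₂ ℤ._*_
          (trans (cong δ (trans (cong (take D) (both⇒derivative≡𝟎 t μ e)) take-𝟎)) (δ-𝟎 D))
          (trans (cong δ (both⇒offset t μ e)) (δ-𝟎 T))

      constant : F₂^ D → Bool
      constant u = (⟨ α₁ ⋆ ι (u ++ 𝟎) , ν₁ ⟩ xor ⟨ α₂ ⋆ ι (u ++ 𝟎) , ν₂ ⟩) xor ⟨ u ++ 𝟎 , μ₁ ⊕ μ₂ ⟩

      functional : F₂^ D → F₂^ E → Bool
      functional u α = ⟨ α ⋆ ι (u ++ 𝟎) , ν₁ ⊕ ν₂ ⟩

      functional-additive : ∀ u → Additive (functional u)
      functional-additive u x y = trans (cong ⟨_, ν₁ ⊕ ν₂ ⟩ (⋆-⊕ˡ x y (ι (u ++ 𝟎)))) (⟨⟩-⊕ˡ (x ⋆ ι (u ++ 𝟎)) (y ⋆ ι (u ++ 𝟎)) (ν₁ ⊕ ν₂))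

      -- The transpose of the linear part of the truncated derivative; its injectivity means that
      -- this linear part has rank D.
      adjoint : F₂^ D → F₂^ (E + E)
      adjoint u = ((α₁ ⊕ α₂) ⋆ ι (u ++ 𝟎)) ++ dual (functional u)

      ⟨⟩-Q-shift : ∀ w t τ → ⟨ w , Q (t ⊕ τ) ⟩ ≡
        (⟨ drop E t ⋆ ι w , take E t ⟩ xor ⟨ drop E t ⋆ ι w , take E τ ⟩) xor
        (⟨ drop E τ ⋆ ι w , take E t ⟩ xor ⟨ drop E τ ⋆ ι w , take E τ ⟩)
      ⟨⟩-Q-shift w t τ = begin
        ⟨ w , Q (t ⊕ τ) ⟩ ≡⟨ ⟨⟩-Q w (t ⊕ τ) ⟩
        ⟨ drop E (t ⊕ τ) ⋆ ι w , take E (t ⊕ τ) ⟩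
          ≡⟨ cong₂ (λ a b → ⟨ a ⋆ ι w , b ⟩) (drop-zipWith {m = E} _xor_ t τ) (take-zipWith {m = E} _xor_ t τ) ⟩
        ⟨ (drop E t ⊕ drop E τ) ⋆ ι w , take E t ⊕ take E τ ⟩
          ≡⟨ cong ⟨_, take E t ⊕ take E τ ⟩ (⋆-⊕ˡ (drop E t) (drop E τ) (ι w)) ⟩
        ⟨ drop E t ⋆ ι w ⊕ drop E τ ⋆ ι w , take E t ⊕ take E τ ⟩
          ≡⟨ ⟨⟩-⊕ˡ (drop E t ⋆ ι w) (drop E τ ⋆ ι w) (take E t ⊕ take E τ) ⟩
        ⟨ drop E t ⋆ ι w , take E t ⊕ take E τ ⟩ xor ⟨ drop E τ ⋆ ι w , take E t ⊕ take E τ ⟩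
          ≡⟨ cong₂ _xor_ (⟨⟩-⊕ʳ (drop E t ⋆ ι w) (take E t) (take E τ)) (⟨⟩-⊕ʳ (drop E τ ⋆ ι w) (take E t) (take E τ)) ⟩
        _ ∎
        where open ≡-Reasoning

      ⟨⟩-adjoint : ∀ u t → ⟨ t , adjoint u ⟩ ≡
        (⟨ α₁ ⋆ ι (u ++ 𝟎) , take E t ⟩ xor ⟨ α₂ ⋆ ι (u ++ 𝟎) , take E t ⟩) xor
        (⟨ drop E t ⋆ ι (u ++ 𝟎) , ν₁ ⟩ xor ⟨ drop E t ⋆ ι (u ++ 𝟎) , ν₂ ⟩)
      ⟨⟩-adjoint u t = begin
        ⟨ t , adjoint u ⟩ ≡⟨ sym (cong ⟨_, adjoint u ⟩ (take++drop≡id E t)) ⟩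
        ⟨ take E t ++ drop E t , adjoint u ⟩ ≡⟨ ⟨⟩-++ (take E t) ((α₁ ⊕ α₂) ⋆ s) ⟩
        ⟨ take E t , (α₁ ⊕ α₂) ⋆ s ⟩ xor ⟨ drop E t , dual (functional u) ⟩
          ≡⟨ cong₂ _xor_ (⟨⟩-comm (take E t) _) (⟨⟩-dual (functional u) (functional-additive u) (drop E t)) ⟩
        ⟨ (α₁ ⊕ α₂) ⋆ s , take E t ⟩ xor ⟨ drop E t ⋆ s , ν₁ ⊕ ν₂ ⟩
          ≡⟨ cong₂ _xor_ (trans (cong ⟨_, take E t ⟩ (⋆-⊕ˡ α₁ α₂ s)) (⟨⟩-⊕ˡ (α₁ ⋆ s) (α₂ ⋆ s) (take E t)))
               (⟨⟩-⊕ʳ (drop E t ⋆ s) ν₁ ν₂) ⟩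
        _ ∎
        where
        open ≡-Reasoning
        s = ι (u ++ 𝟎)

      -- The quadratic terms of the two shifts of Q cancel, so the derivative is affine.
      derivative-affine : ∀ u t → ⟨ u , take D (derivative t) ⟩ ≡ constant u xor ⟨ t , adjoint u ⟩
      derivative-affine u t = begin
        ⟨ u , take D (derivative t) ⟩ ≡⟨ sym (⟨⟩-take D u (derivative t)) ⟩
        ⟨ w , derivative t ⟩ ≡⟨ ⟨⟩-⊕ʳ w (Q (t ⊕ τ₁) ⊕ Q (t ⊕ τ₂)) (μ₁ ⊕ μ₂) ⟩
        ⟨ w , Q (t ⊕ τ₁) ⊕ Q (t ⊕ τ₂) ⟩ xor ⟨ w , μ₁ ⊕ μ₂ ⟩
          ≡⟨ cong (_xor ⟨ w , μ₁ ⊕ μ₂ ⟩) (trans (⟨⟩-⊕ʳ w (Q (t ⊕ τ₁)) (Q (t ⊕ τ₂)))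
               (cong₂ _xor_ (⟨⟩-Q-shift w t τ₁) (⟨⟩-Q-shift w t τ₂))) ⟩
        (((⟨ a ⋆ s , n ⟩ xor ⟨ a ⋆ s , ν₁ ⟩) xor (⟨ α₁ ⋆ s , n ⟩ xor ⟨ α₁ ⋆ s , ν₁ ⟩)) xor
         ((⟨ a ⋆ s , n ⟩ xor ⟨ a ⋆ s , ν₂ ⟩) xor (⟨ α₂ ⋆ s , n ⟩ xor ⟨ α₂ ⋆ s , ν₂ ⟩))) xor ⟨ w , μ₁ ⊕ μ₂ ⟩
          ≡⟨ solve 8 (λ q b₁ c₁ d₁ b₂ c₂ d₂ m →
               (((q :+ b₁) :+ (c₁ :+ d₁)) :+ ((q :+ b₂) :+ (c₂ :+ d₂))) :+ m :=
               ((d₁ :+ d₂) :+ m) :+ ((c₁ :+ c₂) :+ (b₁ :+ b₂))) refl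
               ⟨ a ⋆ s , n ⟩ ⟨ a ⋆ s , ν₁ ⟩ ⟨ α₁ ⋆ s , n ⟩ ⟨ α₁ ⋆ s , ν₁ ⟩
               ⟨ a ⋆ s , ν₂ ⟩ ⟨ α₂ ⋆ s , n ⟩ ⟨ α₂ ⋆ s , ν₂ ⟩ ⟨ w , μ₁ ⊕ μ₂ ⟩ ⟩
        constant u xor ((⟨ α₁ ⋆ s , n ⟩ xor ⟨ α₂ ⋆ s , n ⟩) xor (⟨ a ⋆ s , ν₁ ⟩ xor ⟨ a ⋆ s , ν₂ ⟩))
          ≡⟨ sym (cong (constant u xor_) (⟨⟩-adjoint u t)) ⟩
        constant u xor ⟨ t , adjoint u ⟩ ∎
        where
        open ≡-Reasoning
        open xor-∧-Solver using (solve; _:+_; _:=_)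
        w = u ++ 𝟎
        s = ι w
        a = drop E t
        n = take E t

      -- Suppose s = ι(u, 0) is nonzero. The first half gives (α₁ + α₂) s = 0, hence α₁ = α₂. By the
      -- second half ν₁ + ν₂ is orthogonal to all multiples of s, which are all vectors, hence ν₁ =
      -- ν₂. So s = 0, and u = 0 since ι is injective there.
      adjoint-injective : τ₁ ≢ τ₂ → ∀ u → adjoint u ≡ 𝟎 → u ≡ 𝟎
      adjoint-injective τ₁≢τ₂ u e with ι (u ++ 𝟎) ≟𝟎
      ... | yes s≡𝟎 = ι-injective u s≡𝟎
      ... | no s≢𝟎 = contradiction τ₁≡τ₂ τ₁≢τ₂
        where
        s = ι (u ++ 𝟎)

        halves : ((α₁ ⊕ α₂) ⋆ s ≡ 𝟎) × (dual (functional u) ≡ 𝟎)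
        halves = ++-injective ((α₁ ⊕ α₂) ⋆ s) 𝟎 (trans e (sym (𝟎-++ E)))

        α₁≡α₂ : α₁ ≡ α₂
        α₁≡α₂ = ⊕-≡𝟎 (⋆≡𝟎 (α₁ ⊕ α₂) s≢𝟎 (proj₁ halves))

        ν₁≡ν₂ : ν₁ ≡ ν₂
        ν₁≡ν₂ = ⊕-≡𝟎 (⟨⟩-nondegenerate (ν₁ ⊕ ν₂) (λ x → begin
          ⟨ x , ν₁ ⊕ ν₂ ⟩ ≡⟨ sym (cong ⟨_, ν₁ ⊕ ν₂ ⟩ (÷-⋆ x s≢𝟎)) ⟩
          functional u (x ÷ s) ≡⟨ sym (⟨⟩-dual (functional u) (functional-additive u) (x ÷ s)) ⟩
          ⟨ x ÷ s , dual (functional u) ⟩ ≡⟨ cong ⟨ x ÷ s ,_⟩ (proj₂ halves) ⟩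
          ⟨ x ÷ s , 𝟎 ⟩ ≡⟨ trans (⟨⟩-comm (x ÷ s) 𝟎) (⟨⟩-𝟎ˡ (x ÷ s)) ⟩
          false ∎))
          where open ≡-Reasoning

        τ₁≡τ₂ : τ₁ ≡ τ₂
        τ₁≡τ₂ = trans (sym (take++drop≡id E τ₁)) (trans (cong₂ _++_ ν₁≡ν₂ α₁≡α₂) (take++drop≡id E τ₂))

    -- If τ₁ and τ₂ differ, common points are bounded by the zeros of an affine map of rank D. If
    -- they agree, the shifts differ only in the μ direction, and a graph has one point in each
    -- fibre, so the shifts are disjoint.
    shiftInter-++ : τ₁ ++ μ₁ ≢ τ₂ ++ μ₂ → 2 ^ D * shiftInterSize f (τ₁ ++ μ₁) (τ₂ ++ μ₂) ≤ 2 ^ (E + E)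
    shiftInter-++ γ₁≢γ₂ with ≡-dec Bool._≟_ τ₁ τ₂
    ... | no τ₁≢τ₂ = ℤ.drop‿+≤+ (begin
      + (2 ^ D * N) ≡⟨ ℤ.pos-* (2 ^ D) N ⟩
      + (2 ^ D) ℤ.* + N ≤⟨ ℤ.*-monoˡ-≤-nonNeg (+ (2 ^ D)) count-≤ ⟩
      + (2 ^ D) ℤ.* ∑ (λ t → δ (take D (derivative t)))
        ≤⟨ ∑-δ-affine (λ t → take D (derivative t)) constant adjoint derivative-affine (adjoint-injective τ₁≢τ₂) ⟩
      + (2 ^ (E + E)) ∎)
      where
      open ℤ.≤-Reasoning
      N = shiftInterSize f (τ₁ ++ μ₁) (τ₂ ++ μ₂)
    ... | yes refl = subst (λ N → 2 ^ D * N ≤ 2 ^ (E + E)) (sym N≡0) (subst (_≤ 2 ^ (E + E)) (sym (ℕ.*-zeroʳ (2 ^ D))) z≤n)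
      where
      never : ∀ t μ → both (t ++ μ) ≢ true
      never t μ e = γ₁≢γ₂ (cong (τ₁ ++_)
        (⊕-cancelˡ μ (trans (proj₁ (both⇒Q t μ e)) (sym (proj₂ (both⇒Q t μ e))))))

      N≡0 : shiftInterSize f (τ₁ ++ μ₁) (τ₁ ++ μ₂) ≡ 0
      N≡0 = ℕ.n≤0⇒n≡0 (ℤ.drop‿+≤+ (ℤ.≤-trans (ℤ.≤-reflexive count-both) (ℤ.≤-trans
        (∑-mono {E + E} {h = λ _ → 0ℤ} (λ t → ℤ.≤-trans
          (∑-mono {T} {h = λ _ → 0ℤ} (λ μ → indicator-≤ (both (t ++ μ)) ℤ.≤-refl (λ e → contradiction e (never t μ))))
          (ℤ.≤-reflexive (∑-0 {T}))))
        (ℤ.≤-reflexive (∑-0 {E + E})))))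

  shiftInter-f : ∀ γ₁ γ₂ → γ₁ ≢ γ₂ → 2 ^ D * shiftInterSize f γ₁ γ₂ ≤ 2 ^ (E + E)
  shiftInter-f γ₁ γ₂ γ₁≢γ₂ = subst₂ (λ γ₁ γ₂ → 2 ^ D * shiftInterSize f γ₁ γ₂ ≤ 2 ^ (E + E)) (split γ₁) (split γ₂)
    (shiftInter-++ (take (E + E) γ₁) (take (E + E) γ₂) (drop (E + E) γ₁) (drop (E + E) γ₂) (λ e → γ₁≢γ₂ (trans (sym (split γ₁)) (trans e (split γ₂)))))
    where
    split : (γ : F₂^ ((E + E) + T)) → take (E + E) γ ++ drop (E + E) γ ≡ γ
    split = take++drop≡id (E + E)

-- Choice of the parameters

SparselyShifted : ℕ → ℕ → Set
SparselyShifted k n = Σ (F₂^ n → ℤ) (λ f →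
  IsSignFunction f ×
  (2 ^ (6 * k) ≤ suppSize f) ×
  ((γ₁ γ₂ : F₂^ n) → γ₁ ≢ γ₂ → shiftInterSize f γ₁ γ₂ ≤ 2 ^ (5 * k + 4)))

-- The support has at least 2^(2E) points with 2E at least 6k. For the shifts, 2^(2E) is at most 2^D
-- 2^(5k + 4), and 2^D cancels.
fromEmbedding : ∀ k {E D r} (F : BinaryField E) (s₀ : F₂^ E) (ι : F₂^ (D + r) → F₂^ E) →
  (∀ x y → ι (x ⊕ y) ≡ ι x ⊕ ι y) → (∀ w → s₀ ⊕ ι w ≢ 𝟎) → (∀ (u : F₂^ D) → ι (u ++ 𝟎) ≡ 𝟎 → u ≡ 𝟎) →
  3 * k ≤ E → E + E ≤ D + (5 * k + 4) → SparselyShifted k ((E + E) + (D + r))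
fromEmbedding k {E} {D} {r} F s₀ ι ι-⊕ s₀⊕ι≢𝟎 ι-injective 3k≤E 2E≤ =
  C.f , C.f-isSign ,
  ℕ.≤-trans (ℕ.^-monoʳ-≤ 2 6k≤2E) C.suppSize-f ,
  λ γ₁ γ₂ γ₁≢γ₂ → ℕ.*-cancelˡ-≤ (2 ^ D) {{ℕ.m^n≢0 2 D}} (ℕ.≤-trans (C.shiftInter-f γ₁ γ₂ γ₁≢γ₂)
    (ℕ.≤-trans (ℕ.^-monoʳ-≤ 2 2E≤) (ℕ.≤-reflexive (ℕ.^-distribˡ-+-* 2 D (5 * k + 4)))))
  where
  module C = Construction {D = D} {r = r} F s₀ ι ι-⊕ s₀⊕ι≢𝟎 ι-injective

  6k≤2E : 6 * k ≤ E + E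
  6k≤2E = ℕ.≤-trans (ℕ.≤-reflexive (ℕ.*-distribʳ-+ k 3 3)) (ℕ.+-mono-≤ 3k≤E 3k≤E)

-- With first coordinate 1 in s₀ and 0 throughout the image of ι, the sum s₀ + ι(w) is never 0. That
-- coordinate is the reason for the successor in E = 1 + D + p.
fromField : ∀ k {E} D p r → E ≡ suc (D + p) → BinaryField E → 3 * k ≤ E → E + E ≤ D + (5 * k + 4) →
  SparselyShifted k ((E + E) + (D + r))
fromField k D p r refl F = fromEmbedding k F (true ∷ 𝟎) ι ι-⊕ (λ _ ()) ι-injective
  where
  ι : F₂^ (D + r) → F₂^ (suc (D + p))
  ι w = false ∷ (take D w ++ 𝟎)

  ι-⊕ : ∀ x y → ι (x ⊕ y) ≡ ι x ⊕ ι y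
  ι-⊕ x y = cong (false ∷_) (trans
    (cong₂ _++_ (take-zipWith {m = D} _xor_ x y) (sym (⊕-self 𝟎)))
    (sym (zipWith-++ _xor_ (take D x) 𝟎 (take D y) 𝟎)))

  ι-injective : ∀ (u : F₂^ D) → ι (u ++ 𝟎) ≡ 𝟎 → u ≡ 𝟎
  ι-injective u e = trans (sym (take-++ u 𝟎))
    (++-injectiveˡ (take D (u ++ 𝟎)) 𝟎 (trans (∷-injectiveʳ e) (sym (𝟎-++ D))))

-- The degrees 2 ^ j and 2 ^ j * 3 leave no gap of ratio above 3 / 2.
bracket : ∀ N → 3 ≤ N → ∃ λ j → 2 ^ j * 2 < N × N ≤ 2 ^ j * 4
bracket (suc N) 3≤1+N with ℕ.m≤n⇒m<n∨m≡n 3≤1+N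
... | inj₂ refl = 0 , s≤s (s≤s (s≤s z≤n)) , s≤s (s≤s (s≤s z≤n))
... | inj₁ (s≤s 3≤N) with bracket N 3≤N
...   | j , low , high with ℕ.m≤n⇒m<n∨m≡n high
...     | inj₁ high′ = j , ℕ.m<n⇒m<1+n low , high′
...     | inj₂ refl = suc j , s≤s (ℕ.≤-reflexive (eq (2 ^ j))) , bound
  where
  open +-*-Solver using (solve; con; _:+_; _:*_; _:=_)

  eq : ∀ x → (2 * x) * 2 ≡ x * 4
  eq = solve 1 (λ x → (con 2 :* x) :* con 2 := x :* con 4) refl

  bound : suc (2 ^ j * 4) ≤ (2 * 2 ^ j) * 4
  bound = begin
    suc (2 ^ j * 4) ≤⟨ ℕ.+-monoˡ-≤ (2 ^ j * 4) (ℕ.≤-trans (s≤s z≤n) 3≤N) ⟩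
    2 ^ j * 4 + 2 ^ j * 4 ≡⟨ solve 1 (λ x → x :* con 4 :+ x :* con 4 := (con 2 :* x) :* con 4) refl (2 ^ j) ⟩
    (2 * 2 ^ j) * 4 ∎
    where open ℕ.≤-Reasoning

-- For N between 2 · 2^j and 4 · 2^j, the degree 3 · 2^j serves when it reaches N, with ratio below
-- 3 / 2. Otherwise N exceeds 3 · 2^j, and 4 · 2^j has ratio below 4 / 3.
nearbyField : ∀ N → 3 ≤ N → ∃ λ E → BinaryField E × N ≤ E × 2 * E < 3 * N
nearbyField N 3≤N with bracket N 3≤N
... | j , low , high with N ≤? 2 ^ j * 3
...   | yes N≤ = 2 ^ j * 3 , tower GF8 j , N≤ , (begin-strict
  2 * (2 ^ j * 3) ≡⟨ solve 1 (λ x → con 2 :* (x :* con 3) := con 3 :* (x :* con 2)) refl (2 ^ j) ⟩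
  3 * (2 ^ j * 2) <⟨ ℕ.*-monoʳ-< 3 low ⟩
  3 * N ∎)
  where
  open ℕ.≤-Reasoning
  open +-*-Solver using (solve; con; _:*_; _:=_)
...   | no N≰ = 2 ^ (2 + j) * 1 , tower GF2 (2 + j) , ℕ.≤-trans high (ℕ.≤-reflexive (eq (2 ^ j))) , (begin-strict
  2 * (2 ^ (2 + j) * 1) ≡⟨ solve 1 (λ x → con 2 :* ((con 2 :* (con 2 :* x)) :* con 1) := x :* con 8) refl (2 ^ j) ⟩
  2 ^ j * 8 ≤⟨ ℕ.*-monoʳ-≤ (2 ^ j) (ℕ.n≤1+n 8) ⟩
  2 ^ j * 9 ≡⟨ solve 1 (λ x → x :* con 9 := con 3 :* (x :* con 3)) refl (2 ^ j) ⟩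
  3 * (2 ^ j * 3) <⟨ ℕ.*-monoʳ-< 3 (ℕ.≰⇒> N≰) ⟩
  3 * N ∎)
  where
  open ℕ.≤-Reasoning
  open +-*-Solver using (solve; con; _:*_; _:=_)

  eq : ∀ x → x * 4 ≡ (2 * (2 * x)) * 1
  eq = solve 1 (λ x → x :* con 4 := (con 2 :* (con 2 :* x)) :* con 1) refl

6k≤2^k : ∀ k → 5 ≤ k → 6 * k ≤ 2 ^ k
6k≤2^k (suc k) 5≤1+k with ℕ.m≤n⇒m<n∨m≡n 5≤1+k
... | inj₂ refl = toWitness {a? = 30 ≤? 32} _
... | inj₁ (s≤s 5≤k) = begin
  6 * suc k ≡⟨ ℕ.*-suc 6 k ⟩
  6 + 6 * k ≤⟨ ℕ.+-monoˡ-≤ (6 * k) (ℕ.*-monoʳ-≤ 6 (ℕ.≤-trans (s≤s z≤n) 5≤k)) ⟩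
  6 * k + 6 * k ≤⟨ ℕ.+-mono-≤ (6k≤2^k k 5≤k) (6k≤2^k k 5≤k) ⟩
  2 ^ k + 2 ^ k ≡⟨ cong (λ x → 2 ^ k + x) (ℕ.+-identityʳ (2 ^ k)) ⟨
  2 ^ suc k ∎
  where open ℕ.≤-Reasoning

-- For k ≤ 4 the bound E < 9k/2 of nearbyField would not give 4E ≤ 2ᵏ + 12k + 4.
Degree : ℕ → Set₁
Degree k = ∃ λ E → BinaryField E × 3 * k ≤ E × E < 5 * k + 4 × 4 * E ≤ 2 ^ k + (12 * k + 4)

-- From 2E < 9k follow 2E < 10k + 8 and 4E < 18k = 6k + 12k, where 6k is at most 2^k.
degree-≥5 : ∀ k → 5 ≤ k → Degree k
degree-≥5 k 5≤k with nearbyField (3 * k) (ℕ.*-monoʳ-≤ 3 (ℕ.≤-trans (s≤s z≤n) 5≤k))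
... | E , F , 3k≤E , 2E<9k = E , F , 3k≤E , ℕ.*-cancelˡ-< 2 E (5 * k + 4) (begin-strict
    2 * E <⟨ 2E<9k ⟩
    3 * (3 * k) ≤⟨ ℕ.m≤m+n (3 * (3 * k)) (k + 8) ⟩
    3 * (3 * k) + (k + 8) ≡⟨ solve 1 (λ k → con 3 :* (con 3 :* k) :+ (k :+ con 8) := con 2 :* (con 5 :* k :+ con 4)) refl k ⟩
    2 * (5 * k + 4) ∎) , (begin
    4 * E ≡⟨ ℕ.*-assoc 2 2 E ⟩
    2 * (2 * E) ≤⟨ ℕ.*-monoʳ-≤ 2 (ℕ.<⇒≤ 2E<9k) ⟩
    2 * (3 * (3 * k)) ≤⟨ ℕ.m≤m+n (2 * (3 * (3 * k))) 4 ⟩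
    2 * (3 * (3 * k)) + 4 ≡⟨ solve 1 (λ k → con 2 :* (con 3 :* (con 3 :* k)) :+ con 4 := con 6 :* k :+ (con 12 :* k :+ con 4)) refl k ⟩
    6 * k + (12 * k + 4) ≤⟨ ℕ.+-monoˡ-≤ (12 * k + 4) (6k≤2^k k 5≤k) ⟩
    2 ^ k + (12 * k + 4) ∎)
  where
  open ℕ.≤-Reasoning
  open +-*-Solver using (solve; con; _:+_; _:*_; _:=_)

degree : ∀ k → 3 ≤ k → Degree k
degree k 3≤k with ℕ.m≤n⇒m<n∨m≡n 3≤k
-- For k = 3 the degree 12 = 4 · 3 meets the last bound with equality: 48 = 8 + 36 + 4.
... | inj₂ refl = 12 , tower GF8 2 ,
  toWitness {a? = 9 ≤? 12} _ , toWitness {a? = 13 ≤? 19} _ , toWitness {a? = 48 ≤? 48} _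
... | inj₁ 4≤k with ℕ.m≤n⇒m<n∨m≡n 4≤k
...   | inj₂ refl = 12 , tower GF8 2 ,
  toWitness {a? = 12 ≤? 12} _ , toWitness {a? = 13 ≤? 24} _ , toWitness {a? = 48 ≤? 68} _
...   | inj₁ 5≤k = degree-≥5 k 5≤k

theorem3p1 : (k : ℕ) → 3 ≤ k →
    Σ (F₂^ (2 ^ k + 7 * k) → ℤ) (λ f →
    IsSignFunction f ×
    (2 ^ (6 * k) ≤ suppSize f) ×
    ((γ₁ γ₂ : F₂^ (2 ^ k + 7 * k)) → γ₁ ≢ γ₂ →
    shiftInterSize f γ₁ γ₂ ≤ 2 ^ (5 * k + 4)))
theorem3p1 k 3≤k with degree k 3≤k
... | E , F , 3k≤E , E<5k+4 , 4E≤ = subst (SparselyShifted k) n-eq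
  (fromField k D p r E-eq F 3k≤E 2E≤D+5k+4)
  where
  open ℕ.≤-Reasoning
  open +-*-Solver using (solve; con; _:+_; _:*_; _:=_)

  D p r n : ℕ
  -- The least D that gives the bound on the intersections. The numbers p and r fill up the degree,
  -- E = 1 + D + p, and the dimension, n = 2E + D + r.
  D = (E + E) ∸ (5 * k + 4)
  p = E ∸ suc D
  n = 2 ^ k + 7 * k
  r = n ∸ ((E + E) + D)

  2E≤D+5k+4 : E + E ≤ D + (5 * k + 4)
  2E≤D+5k+4 = ℕ.≤-trans (ℕ.m≤n+m∸n (E + E) (5 * k + 4)) (ℕ.≤-reflexive (ℕ.+-comm (5 * k + 4) D))

  -- If the subtraction is truncated, D = 0 and E is positive; otherwise the claim amounts to E < 5k
  -- + 4.
  D<E : D < E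
  D<E with E + E ≤? 5 * k + 4
  ... | yes 2E≤ = subst (_< E) (sym (ℕ.m≤n⇒m∸n≡0 2E≤))
    (ℕ.≤-trans (s≤s z≤n) (ℕ.≤-trans 3≤k (ℕ.≤-trans (ℕ.m≤n*m k 3) 3k≤E)))
  ... | no 2E≰ = ℕ.+-cancelʳ-< (5 * k + 4) D E (begin-strict
    D + (5 * k + 4) ≡⟨ ℕ.m∸n+n≡m (ℕ.≰⇒≥ 2E≰) ⟩
    E + E <⟨ ℕ.+-monoʳ-< E E<5k+4 ⟩
    E + (5 * k + 4) ∎)

  -- If the subtraction is truncated, 2E is at most 5k + 4, and 4 is at most 2k; otherwise adding 5k
  -- + 4 to both sides gives the bound on 4E.
  2E+D≤n : (E + E) + D ≤ n
  2E+D≤n with E + E ≤? 5 * k + 4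
  ... | yes 2E≤ = begin
    (E + E) + D ≡⟨ cong (λ x → (E + E) + x) (ℕ.m≤n⇒m∸n≡0 2E≤) ⟩
    (E + E) + 0 ≡⟨ ℕ.+-identityʳ (E + E) ⟩
    E + E ≤⟨ 2E≤ ⟩
    5 * k + 4 ≤⟨ ℕ.+-monoʳ-≤ (5 * k) (ℕ.≤-trans (ℕ.n≤1+n 4) (ℕ.≤-trans (ℕ.n≤1+n 5) (ℕ.*-monoʳ-≤ 2 3≤k))) ⟩
    5 * k + 2 * k ≡⟨ ℕ.*-distribʳ-+ k 5 2 ⟨
    7 * k ≤⟨ ℕ.m≤n+m (7 * k) (2 ^ k) ⟩
    n ∎
  ... | no 2E≰ = ℕ.+-cancelʳ-≤ (5 * k + 4) ((E + E) + D) n (begin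
    (E + E) + D + (5 * k + 4) ≡⟨ ℕ.+-assoc (E + E) D (5 * k + 4) ⟩
    (E + E) + (D + (5 * k + 4)) ≡⟨ cong (λ x → (E + E) + x) (ℕ.m∸n+n≡m (ℕ.≰⇒≥ 2E≰)) ⟩
    (E + E) + (E + E) ≡⟨ solve 1 (λ E → (E :+ E) :+ (E :+ E) := con 4 :* E) refl E ⟩
    4 * E ≤⟨ 4E≤ ⟩
    2 ^ k + (12 * k + 4) ≡⟨ solve 2 (λ x k → x :+ (con 12 :* k :+ con 4) := (x :+ con 7 :* k) :+ (con 5 :* k :+ con 4)) refl (2 ^ k) k ⟩
    n + (5 * k + 4) ∎)

  E-eq : E ≡ suc (D + p)
  E-eq = sym (ℕ.m+[n∸m]≡n D<E)

  n-eq : (E + E) + (D + r) ≡ n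
  n-eq = trans (sym (ℕ.+-assoc (E + E) D r)) (ℕ.m+[n∸m]≡n 2E+D≤n)
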